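{- The $\ell_\infty$ necklace alignment problem on two necklaces with $n$ beads each can be reduced in $O(n)$ time to one $(\min,-)$ convolution and one $(\max,-)$ convolution of vectors of length $2n$ (with entries in $\mathbb R\cup\{\pm\infty\}$): that is, from the input one can construct in $O(n)$ time vectors $\vec x',\vec x'',\vec y'$ of length $2n$ such that, given $\vec x' \ast_{\min}^{ - }\vec y'$ and $\vec x''\ast_{\max}^{ - }\vec y'$, an optimal solution (value, offset and shift) can be computed in $O(n)$ additional time.
   Context: Necklace alignment ($\ell_\infty$ version): given sorted vectors $\vec x=\langle x_0,\dots,x_{n-1}\rangle$, $\vec y=\langle y_0,\dots,y_{n-1}\rangle$ of reals in $[0,1)$, find $c\in[0,1)$ and $s\in\{0,\dots,n-1\}$ minimizing $\max_{i}d^\circ((x_i+c)\bmod 1,\,y_{(i+s)\bmod n})$, where $d^\circ(a,b)=\min\{|a-b|,1-|a-b|\}$. For vectors $\vec a=\langle a_0,\dots,a_{m-1}\rangle$, $\vec b=\langle b_0,\dots,b_{m-1}\rangle$, the $(\min,-)$ convolution $\vec a\ast_{\min}^{ - }\vec b$ is the vector whose $k$th entry is $\min_{i=0}^{k}(a_i-b_{k-i})$, and the $(\max,-)$ convolution $\vec a\ast_{\max}^{ - }\vec b$ has $k$th entry $\max_{i=0}^{k}(a_i-b_{k-i})$, for $k=0,\dots,m-1$. -}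

module Defs where

open import Algebra.Bundles using (CommutativeRing)
open import Data.Bool.Base using (Bool; true; false; if_then_else_)
open import Data.Fin.Base as Fin using (Fin; toℕ; inject≤; opposite)
open import Data.Fin.Properties using (toℕ<n)
open import Data.Nat.Base as ℕ using (ℕ; suc; NonZero)
open import Data.Nat.DivMod using (_mod_)
open import Data.Product.Base using (Σ; Σ-syntax; _×_; _,_)
open import Data.Empty using (⊥)
open import Data.Sum.Base using (_⊎_; inj₁; inj₂; [_,_]′)
open import Data.Unit.Base using (⊤)
open import Data.Vec.Functional using (Vector; foldr; head; tail)
open import Level using (Level; _⊔_) renaming (suc to lsuc)
open import Relation.Binary.Bundles using (TotalOrder; DecTotalOrder)
open import Relation.Binary.Core using (Rel)
open import Relation.Binary.PropositionalEquality.Core using (_≡_)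
open import Relation.Binary.Structures using (IsDecTotalOrder)
open import Relation.Nullary.Construct.Add.Extrema using (_±; ⊥±; ⊤±; [_])
open import Relation.Nullary.Decidable.Core using (yes; no; does)
open import Relation.Nullary.Negation.Core using (¬_; contradiction)
import Algebra.Construct.NaturalChoice.Max as Max
import Algebra.Construct.NaturalChoice.Min as Min
import Relation.Binary.Construct.Add.Extrema.NonStrict as Order±
import Relation.Binary.Construct.NonStrictToStrict as ToStrict
import Algebra.Properties.Ring as RingProperties

-- Dedekind-complete ordered fields, which classically are exactly the
-- copies of ℝ.  Decidability of the order is the unit-cost comparison of
-- the real RAM.  The value of _⁻¹ at 0# is irrelevant.

record Reals (c ℓ₁ ℓ₂ : Level) : Set (lsuc (c ⊔ ℓ₁ ⊔ ℓ₂)) where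
  infix 4 _≤_
  infix 8 _⁻¹
  field
    commutativeRing : CommutativeRing c ℓ₁

  open CommutativeRing commutativeRing public

  field
    _≤_             : Rel Carrier ℓ₂
    isDecTotalOrder : IsDecTotalOrder _≈_ _≤_
    +-monoˡ-≤       : ∀ z {x y} → x ≤ y → x + z ≤ y + z
    *-nonNeg        : ∀ {x y} → 0# ≤ x → 0# ≤ y → 0# ≤ x * y
    1≉0             : ¬ (1# ≈ 0#)
    _⁻¹             : Carrier → Carrier
    *-inverseʳ      : ∀ x → ¬ (x ≈ 0#) → x * x ⁻¹ ≈ 1#

  UpperBound : (Carrier → Set (c ⊔ ℓ₁ ⊔ ℓ₂)) → Carrier → Set (c ⊔ ℓ₁ ⊔ ℓ₂)
  UpperBound P u = ∀ x → P x → x ≤ u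

  field
    complete : ∀ (P : Carrier → Set (c ⊔ ℓ₁ ⊔ ℓ₂)) →
               Σ Carrier P → Σ Carrier (UpperBound P) →
               Σ[ s ∈ Carrier ] (UpperBound P s × (∀ u → UpperBound P u → s ≤ u))

  decTotalOrder : DecTotalOrder c ℓ₁ ℓ₂
  decTotalOrder = record { isDecTotalOrder = isDecTotalOrder }

  open DecTotalOrder decTotalOrder public using (_≤?_; totalOrder)
  open ToStrict _≈_ _≤_ public using (_<_)

-- Real-RAM programs.  There is one index memory of natural numbers and a
-- family of memory banks whose cells contain elements of ℝ ∪ {±∞}; all
-- memories are unbounded and indirectly addressable.  No operation turns a
-- real number into an index (in particular there is no floor).

infixl 6 _⊕_ _⊖_

data IExp : Set where
  lit     : ℕ → IExp
  load    : IExp → IExp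
  _⊕_ _⊖_ : IExp → IExp → IExp        -- _⊖_ is truncated subtraction

infixl 6 _⊞_ _⊟_
infixl 7 _⊠_ _⊘_

data RExp : Set where
  zeroᴿ oneᴿ +∞ -∞ : RExp
  fetch            : ℕ → IExp → RExp   -- bank, address
  _⊞_ _⊟_ _⊠_ _⊘_  : RExp → RExp → RExp

infix 5 _≤ᴵ_ _≤ᴿ_

data Test : Set where
  _≤ᴵ_ : IExp → IExp → Test
  _≤ᴿ_ : RExp → RExp → Test

infixr 3 _⨾_
infix  4 _≔ᴵ_ _at_≔ᴿ_

data Program : Set where
  skip          : Program
  _≔ᴵ_          : IExp → IExp → Program          -- address, new content
  _at_≔ᴿ_       : ℕ → IExp → RExp → Program      -- bank, address, new content
  _⨾_           : Program → Program → Program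
  if_then_else′_ : Test → Program → Program → Program
  while_loop_   : Test → Program → Program

module OverReals {c ℓ₁ ℓ₂ : Level} (R : Reals c ℓ₁ ℓ₂) where

  open Reals R renaming (Carrier to ℝ)
  private module O = DecTotalOrder decTotalOrder
  open RingProperties ring using (//-rightDividesˡ; //-rightDividesʳ)
  open Max totalOrder public using () renaming (_⊔_ to _⊔ᴿ_)
  open Min totalOrder public using () renaming (_⊓_ to _⊓ᴿ_)
  open Order± _≤_ public using (_≤±_)

  -- Extended reals

  totalOrder± : TotalOrder c (c ⊔ ℓ₁) (c ⊔ ℓ₂)
  totalOrder± = record
    { isTotalOrder = Order±.≤±-isTotalOrder _≤_ (TotalOrder.isTotalOrder totalOrder) }

  open Max totalOrder± public using () renaming (_⊔_ to _⊔±_)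
  open Min totalOrder± public using () renaming (_⊓_ to _⊓±_)

  -- The difference of two extended reals is undefined for ∞ - ∞ and (-∞) - (-∞).

  Defined : ℝ ± → ℝ ± → Set
  Defined ⊤± ⊤± = ⊥
  Defined ⊥± ⊥± = ⊥
  Defined _  _  = ⊤

  minus : (u v : ℝ ±) → Defined u v → ℝ ±
  minus [ a ] [ b ] _ = [ a - b ]
  minus ⊤±    [ _ ] _ = ⊤±
  minus ⊥±    [ _ ] _ = ⊥±
  minus [ _ ] ⊤±    _ = ⊥±
  minus [ _ ] ⊥±    _ = ⊤±
  minus ⊤±    ⊥±    _ = ⊤±
  minus ⊥±    ⊤±    _ = ⊥±

  -- Convolutions.  For k : Fin m the index i ranges over 0, …, k, that is,
  -- over Fin (suc (toℕ k)), where toℕ (opposite i) ≡ toℕ k ∸ toℕ i.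

  module _ {m : ℕ} where

    left right : (k : Fin m) → Fin (suc (toℕ k)) → Fin m
    left  k i = inject≤ i (toℕ<n k)
    right k i = inject≤ (opposite i) (toℕ<n k)

    Convolvable : Vector (ℝ ±) m → Vector (ℝ ±) m → Set
    Convolvable a b = ∀ k i → Defined (a (left k i)) (b (right k i))

    differences : (a b : Vector (ℝ ±) m) → Convolvable a b →
                  (k : Fin m) → Vector (ℝ ±) (suc (toℕ k))
    differences a b d k i = minus (a (left k i)) (b (right k i)) (d k i)

    minConvolution maxConvolution :
      (a b : Vector (ℝ ±) m) → Convolvable a b → Vector (ℝ ±) m
    minConvolution a b d k = foldr _⊓±_ (head v) (tail v) where v = differences a b d k
    maxConvolution a b d k = foldr _⊔±_ (head v) (tail v) where v = differences a b d k

  -- Necklaces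

  InUnit : ℝ → Set (ℓ₁ ⊔ ℓ₂)
  InUnit a = 0# ≤ a × a < 1#

  record IsNecklace {n : ℕ} (x : Vector ℝ n) : Set (ℓ₁ ⊔ ℓ₂) where
    field
      sorted : ∀ i j → i Fin.≤ j → x i ≤ x j
      inUnit : ∀ i → InUnit (x i)

  ∣_∣ : ℝ → ℝ
  ∣ a ∣ = a ⊔ᴿ (- a)

  d° : ℝ → ℝ → ℝ
  d° a b = ∣ a - b ∣ ⊓ᴿ (1# - ∣ a - b ∣)

  -- Reduction modulo 1 of a number in [0, 2), the only range in which it is
  -- needed: x i + o with both summands in [0, 1).

  _mod1 : ℝ → ℝ
  a mod1 = if does (1# ≤? a) then a - 1# else a

  mod1-inUnit : ∀ a → 0# ≤ a → a < 1# + 1# →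
                InUnit (a mod1) × (a mod1 ≈ a ⊎ a mod1 + 1# ≈ a)
  mod1-inUnit a 0≤a (a≤2 , a≉2) with 1# ≤? a
  ... | no  1≰a = (0≤a , [ (λ a≤1 → a≤1) , (λ 1≤a → contradiction 1≤a 1≰a) ]′ (O.total a 1#)
                       , λ a≈1 → 1≰a (O.reflexive (sym a≈1)))
                , inj₁ refl
  ... | yes 1≤a = ( O.≤-respˡ-≈ (-‿inverseʳ 1#) (+-monoˡ-≤ (- 1#) 1≤a)
                  , O.≤-respʳ-≈ (//-rightDividesʳ 1# 1#) (+-monoˡ-≤ (- 1#) a≤2)
                  , λ a-1≈1 → a≉2 (trans (sym a-1+1≈a) (+-congʳ a-1≈1)))
                , inj₂ a-1+1≈a
    where
    a-1+1≈a : a - 1# + 1# ≈ a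
    a-1+1≈a = //-rightDividesˡ 1# a

  maximum : ∀ {n} .{{_ : NonZero n}} → Vector ℝ n → ℝ
  maximum {suc n} v = foldr _⊔ᴿ_ (head v) (tail v)

  module _ {n : ℕ} .{{_ : NonZero n}} (x y : Vector ℝ n) where

    distance : ℝ → Fin n → ℝ
    distance o s = maximum λ i → d° ((x i + o) mod1) (y ((toℕ i ℕ.+ toℕ s) mod n))

    record IsOptimal (v o : ℝ) (s : Fin n) : Set (c ⊔ ℓ₁ ⊔ ℓ₂) where
      field
        offset  : InUnit o
        value   : v ≈ distance o s
        minimal : ∀ o′ s′ → InUnit o′ → v ≤ distance o′ s′

  -- Semantics of programs

  record State : Set c where
    field
      index : ℕ → ℕ
      bank  : ℕ → ℕ → ℝ ±
  open State public

  setIndex : State → ℕ → ℕ → State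
  setIndex σ p k .index q = if p ℕ.≡ᵇ q then k else index σ q
  setIndex σ p k .bank    = bank σ

  setBank : State → ℕ → ℕ → ℝ ± → State
  setBank σ b p u .index    = index σ
  setBank σ b p u .bank b′ q =
    if b ℕ.≡ᵇ b′ then (if p ℕ.≡ᵇ q then u else bank σ b′ q) else bank σ b′ q

  ⟦_⟧ : IExp → State → ℕ
  ⟦ lit k  ⟧ σ = k
  ⟦ load e ⟧ σ = index σ (⟦ e ⟧ σ)
  ⟦ e ⊕ f  ⟧ σ = ⟦ e ⟧ σ ℕ.+ ⟦ f ⟧ σ
  ⟦ e ⊖ f  ⟧ σ = ⟦ e ⟧ σ ℕ.∸ ⟦ f ⟧ σ

  -- Arithmetic is restricted to finite operands, and division to nonzero
  -- divisors; otherwise the program is stuck.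

  infix 4 _⊢_↦_ _⊢_↝_

  data _⊢_↦_ (σ : State) : RExp → ℝ ± → Set (c ⊔ ℓ₁) where
    zeroᴿ : σ ⊢ zeroᴿ ↦ [ 0# ]
    oneᴿ  : σ ⊢ oneᴿ ↦ [ 1# ]
    +∞    : σ ⊢ +∞ ↦ ⊤±
    -∞    : σ ⊢ -∞ ↦ ⊥±
    fetch : ∀ b e → σ ⊢ fetch b e ↦ bank σ b (⟦ e ⟧ σ)
    _⊞_   : ∀ {e f u v} → σ ⊢ e ↦ [ u ] → σ ⊢ f ↦ [ v ] → σ ⊢ e ⊞ f ↦ [ u + v ]
    _⊟_   : ∀ {e f u v} → σ ⊢ e ↦ [ u ] → σ ⊢ f ↦ [ v ] → σ ⊢ e ⊟ f ↦ [ u - v ]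
    _⊠_   : ∀ {e f u v} → σ ⊢ e ↦ [ u ] → σ ⊢ f ↦ [ v ] → σ ⊢ e ⊠ f ↦ [ u * v ]
    quot  : ∀ {e f u v} → σ ⊢ e ↦ [ u ] → σ ⊢ f ↦ [ v ] → ¬ (v ≈ 0#) →
            σ ⊢ e ⊘ f ↦ [ u * v ⁻¹ ]

  data _⊢_↝_ (σ : State) : Test → Bool → Set (c ⊔ ℓ₁ ⊔ ℓ₂) where
    yesᴵ : ∀ {e f} → ⟦ e ⟧ σ ℕ.≤ ⟦ f ⟧ σ → σ ⊢ e ≤ᴵ f ↝ true
    noᴵ  : ∀ {e f} → ¬ (⟦ e ⟧ σ ℕ.≤ ⟦ f ⟧ σ) → σ ⊢ e ≤ᴵ f ↝ false
    yesᴿ : ∀ {e f u v} → σ ⊢ e ↦ u → σ ⊢ f ↦ v → u ≤± v → σ ⊢ e ≤ᴿ f ↝ true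
    noᴿ  : ∀ {e f u v} → σ ⊢ e ↦ u → σ ⊢ f ↦ v → ¬ (u ≤± v) → σ ⊢ e ≤ᴿ f ↝ false

  -- ⟨ p , σ ⟩⇓[ t ] τ : started in σ, p halts in τ after t steps, where each
  -- assignment and each evaluated test is one step.  A program contains
  -- finitely many expressions of fixed size, so charging for every single
  -- operation would change t by a factor depending on p only.

  infix 4 ⟨_,_⟩⇓[_]_

  data ⟨_,_⟩⇓[_]_ : Program → State → ℕ → State → Set (c ⊔ ℓ₁ ⊔ ℓ₂) where
    skip    : ∀ {σ} → ⟨ skip , σ ⟩⇓[ 0 ] σ
    assignᴵ : ∀ {σ a e} → ⟨ a ≔ᴵ e , σ ⟩⇓[ 1 ] setIndex σ (⟦ a ⟧ σ) (⟦ e ⟧ σ)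
    assignᴿ : ∀ {σ b a e u} → σ ⊢ e ↦ u →
              ⟨ b at a ≔ᴿ e , σ ⟩⇓[ 1 ] setBank σ b (⟦ a ⟧ σ) u
    _⨾_    : ∀ {p q σ τ υ s t} → ⟨ p , σ ⟩⇓[ s ] τ → ⟨ q , τ ⟩⇓[ t ] υ →
             ⟨ p ⨾ q , σ ⟩⇓[ s ℕ.+ t ] υ
    if-true  : ∀ {g p q σ τ t} → σ ⊢ g ↝ true → ⟨ p , σ ⟩⇓[ t ] τ →
               ⟨ if g then p else′ q , σ ⟩⇓[ suc t ] τ
    if-false : ∀ {g p q σ τ t} → σ ⊢ g ↝ false → ⟨ q , σ ⟩⇓[ t ] τ →
               ⟨ if g then p else′ q , σ ⟩⇓[ suc t ] τ
    while-true  : ∀ {g p σ τ υ s t} → σ ⊢ g ↝ true → ⟨ p , σ ⟩⇓[ s ] τ →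
                  ⟨ while g loop p , τ ⟩⇓[ t ] υ →
                  ⟨ while g loop p , σ ⟩⇓[ suc (s ℕ.+ t) ] υ
    while-false : ∀ {g p σ} → σ ⊢ g ↝ false → ⟨ while g loop p , σ ⟩⇓[ 1 ] σ

  HaltsWithin : ∀ {ℓ} → Program → State → ℕ → (State → Set ℓ) → Set (c ⊔ ℓ₁ ⊔ ℓ₂ ⊔ ℓ)
  HaltsWithin p σ T Q =
    Σ[ t ∈ ℕ ] Σ[ τ ∈ State ] (⟨ p , σ ⟩⇓[ t ] τ × t ℕ.≤ T × Q τ)

  -- Input and output conventions.  Cells that are not mentioned may contain
  -- anything.

  Holds : State → ℕ → ∀ {m} → Vector (ℝ ±) m → Set c
  Holds σ b v = ∀ i → bank σ b (toℕ i) ≡ v i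

  HoldsInput : ∀ {n} → Vector ℝ n → Vector ℝ n → State → Set c
  HoldsInput {n} x y σ =
    index σ 0 ≡ n × Holds σ 0 (λ i → [ x i ]) × Holds σ 1 (λ i → [ y i ])

  HoldsVectors : ∀ {m} → (x′ x″ y′ : Vector (ℝ ±) m) → State → Set c
  HoldsVectors x′ x″ y′ σ = Holds σ 2 x′ × Holds σ 3 x″ × Holds σ 4 y′

  HoldsConvolutions : ∀ {m} → (z w : Vector (ℝ ±) m) → State → Set c
  HoldsConvolutions z w σ = Holds σ 5 z × Holds σ 6 w

  HoldsSolution : ∀ {n} .{{_ : NonZero n}} → Vector ℝ n → Vector ℝ n →
                  State → Set (c ⊔ ℓ₁ ⊔ ℓ₂)
  HoldsSolution {n} x y σ =
    Σ[ v ∈ ℝ ] Σ[ o ∈ ℝ ] Σ[ s ∈ Fin n ]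
      (bank σ 7 0 ≡ [ v ] × bank σ 7 1 ≡ [ o ] × index σ 1 ≡ toℕ s × IsOptimal x y v o s)

{-# OPTIONS --safe #-}

-- Unroll a necklace to the sequence y_{j + kn} = y_j + k on the line.  If every
-- x_i is within D of some integer translate of y_{i+s}, the translates can be
-- chosen to respect the order, so that for some shift t all differences
-- x_i - y_{i+t} lie in an interval of length 2D.  Conversely, the midpoint of
-- the interval spanned by these differences gives an offset whose circular cost
-- is at most half its length.  The optimum is therefore half the least width,
-- over t, of the differences for t, whose ends are the entries n - 1 + t of the
-- two convolutions of the reversed x, padded with ±∞, with two turns of y.

module Submission where

open import Algebra.Bundles using (CommutativeRing)
open import Algebra.Solver.Ring.AlmostCommutativeRing
  using (AlmostCommutativeRing; fromCommutativeRing; _-Raw-AlmostCommutative⟶_)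
open import Data.Bool.Base using (true; false; if_then_else_)
open import Data.Fin.Base as Fin using (Fin; zero; suc; toℕ; fromℕ<; opposite)
import Data.Fin.Properties as Fin
open import Data.Integer.Base as ℤ using (ℤ; +_; -[1+_])
import Data.Integer.Properties as ℤ
open import Data.Maybe.Base using (map)
open import Data.Nat.Base as ℕ using (ℕ; zero; suc; NonZero; _/_; _%_)
open import Data.Nat.DivMod
  using (_mod_; m%n<n; m≡m%n+[m/n]*n; [m+kn]%n≡m%n; m<n⇒m%n≡m; m<n⇒m/n≡0; 0/n≡0; m<n*o⇒m/o<n;
         +-distrib-/-∣ʳ; m*n/n≡m; /-monoˡ-≤)
open import Data.Nat.Divisibility using (divides-refl)
import Data.Nat.Properties as ℕ
open import Data.Nat.Solver using (module +-*-Solver)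
open import Data.Product.Base using (Σ-syntax; ∃-syntax; _×_; _,_; proj₁; proj₂)
open import Data.Sum.Base using (_⊎_; inj₁; inj₂; [_,_]′)
open import Data.Unit.Base using (tt)
open import Data.Vec.Functional using (Vector; foldr; head; tail)
open import Function.Definitions using (Injective)
import Level
open import Relation.Binary.Bundles using (TotalOrder; DecTotalOrder)
open import Relation.Binary.Construct.Add.Extrema.NonStrict using ([_])
open import Relation.Binary.Construct.Flip.EqAndOrd using () renaming (totalOrder to flip)
open import Relation.Binary.PropositionalEquality.Core as ≡ using (_≡_)
open import Relation.Binary.PropositionalEquality.Properties using (module ≡-Reasoning)
open import Relation.Nullary.Construct.Add.Extrema using (_±; ⊥±; ⊤±; [_])
open import Relation.Nullary.Decidable.Core using (Dec; yes; no; dec⇒maybe; decidable-stable)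
open import Relation.Nullary.Negation.Core using (¬_; contradiction)
open import Defs
import Algebra.Construct.NaturalChoice.Max as Max
import Algebra.Construct.NaturalChoice.Min as Min
import Algebra.Properties.Ring
import Algebra.Properties.Semiring.Mult.TCOptimised
import Algebra.Solver.Ring
import Relation.Binary.Construct.Add.Supremum.NonStrict as Order⁺
import Relation.Binary.Reasoning.Setoid

-- A whole turn added to the shift translates all differences by the same integer, which the offset
-- absorbs modulo one. Hence `n` shifts suffice, and two turns of `y` contain every bead that they
-- reach. The lower bound for arbitrary offsets and shifts rests on the existence of a shift with
-- small spread. The predicates that single it out range over all natural numbers and are not
-- decided, so its existence is proved only up to double negation. That is enough, because the
-- inequality finally drawn from it is decidable. Memory contents are specified up to `_≡_`, whereas
-- the laws of the field hold up to `_≈_`. Therefore `unroll`, `half`, `centre` and the extrema are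
-- written so that their values agree up to `_≡_` with what the programs and the convolutions
-- produce.

module IntegerMultiples {c ℓ} (R : CommutativeRing c ℓ) where

  open CommutativeRing R
  open Algebra.Properties.Ring ring
  open Algebra.Properties.Semiring.Mult.TCOptimised semiring
    using (1+×; ×-homo-+) renaming (_×_ to _×′_)
  open Relation.Binary.Reasoning.Setoid setoid

  fromℕ : ℕ → Carrier
  fromℕ n = n ×′ 1#

  fromℤ : ℤ → Carrier
  fromℤ (+ n)    = fromℕ n
  fromℤ -[1+ n ] = - fromℕ (suc n)

  cancel-+ : ∀ x y z → (x + y) - (x + z) ≈ y - z
  cancel-+ x y z = begin
    (x + y) - (x + z)     ≈⟨ +-cong (+-comm x y) (sym (-‿+-comm x z)) ⟩
    (y + x) + (- x - z)   ≈⟨ +-assoc y x (- x - z) ⟩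
    y + (x + (- x - z))   ≈⟨ +-congˡ (+-assoc x (- x) (- z)) ⟨
    y + ((x - x) - z)     ≈⟨ +-congˡ (+-congʳ (-‿inverseʳ x)) ⟩
    y + (0# - z)          ≈⟨ +-congˡ (+-identityˡ (- z)) ⟩
    y - z                 ∎

  fromℤ-⊖ : ∀ m n → fromℤ (m ℤ.⊖ n) ≈ fromℕ m - fromℕ n
  fromℤ-⊖ m zero = begin
    fromℕ m       ≈⟨ +-identityʳ (fromℕ m) ⟨
    fromℕ m + 0#  ≈⟨ +-congˡ -0#≈0# ⟨
    fromℕ m - 0#  ∎
  fromℤ-⊖ zero    (suc n) = sym (+-identityˡ (- fromℕ (suc n)))
  fromℤ-⊖ (suc m) (suc n) = begin
    fromℤ (suc m ℤ.⊖ suc n)          ≡⟨ ≡.cong fromℤ (ℤ.[1+m]⊖[1+n]≡m⊖n m n) ⟩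
    fromℤ (m ℤ.⊖ n)                  ≈⟨ fromℤ-⊖ m n ⟩
    fromℕ m - fromℕ n                ≈⟨ cancel-+ 1# (fromℕ m) (fromℕ n) ⟨
    (1# + fromℕ m) - (1# + fromℕ n)  ≈⟨ +-cong (1+× m 1#) (-‿cong (1+× n 1#)) ⟨
    fromℕ (suc m) - fromℕ (suc n)    ∎

  fromℤ-neg : ∀ i → fromℤ (ℤ.- i) ≈ - fromℤ i
  fromℤ-neg (+ zero)  = sym -0#≈0#
  fromℤ-neg (+ suc n) = refl
  fromℤ-neg -[1+ n ]  = sym (-‿involutive (fromℕ (suc n)))

  fromℤ-+ : ∀ i j → fromℤ (i ℤ.+ j) ≈ fromℤ i + fromℤ j
  fromℤ-+ (+ m)    (+ n)    = ×-homo-+ 1# m n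
  fromℤ-+ (+ m)    -[1+ n ] = fromℤ-⊖ m (suc n)
  fromℤ-+ -[1+ m ] (+ n)    = trans (fromℤ-⊖ n (suc m)) (+-comm (fromℕ n) (- fromℕ (suc m)))
  fromℤ-+ -[1+ m ] -[1+ n ] = begin
    - fromℕ (suc (suc (m ℕ.+ n)))      ≡⟨ ≡.cong (λ k → - fromℕ k) (ℕ.+-suc (suc m) n) ⟨
    - fromℕ (suc m ℕ.+ suc n)          ≈⟨ -‿cong (×-homo-+ 1# (suc m) (suc n)) ⟩
    - (fromℕ (suc m) + fromℕ (suc n))  ≈⟨ -‿+-comm _ _ ⟨
    - fromℕ (suc m) - fromℕ (suc n)    ∎

  fromℤ-ℕ* : ∀ m j → fromℤ (+ m ℤ.* j) ≈ fromℕ m * fromℤ j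
  fromℤ-ℕ* zero    j = trans (reflexive (≡.cong fromℤ (ℤ.*-zeroˡ j))) (sym (zeroˡ (fromℤ j)))
  fromℤ-ℕ* (suc m) j = begin
    fromℤ (+ suc m ℤ.* j)            ≡⟨ ≡.cong fromℤ (ℤ.suc-* (+ m) j) ⟩
    fromℤ (j ℤ.+ + m ℤ.* j)          ≈⟨ fromℤ-+ j (+ m ℤ.* j) ⟩
    fromℤ j + fromℤ (+ m ℤ.* j)      ≈⟨ +-cong (sym (*-identityˡ (fromℤ j))) (fromℤ-ℕ* m j) ⟩
    1# * fromℤ j + fromℕ m * fromℤ j ≈⟨ distribʳ (fromℤ j) 1# (fromℕ m) ⟨
    (1# + fromℕ m) * fromℤ j         ≈⟨ *-congʳ (1+× m 1#) ⟨
    fromℕ (suc m) * fromℤ j          ∎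

  fromℤ-* : ∀ i j → fromℤ (i ℤ.* j) ≈ fromℤ i * fromℤ j
  fromℤ-* (+ m)    j = fromℤ-ℕ* m j
  fromℤ-* -[1+ m ] j = begin
    fromℤ (ℤ.- (+ suc m) ℤ.* j)      ≡⟨ ≡.cong fromℤ (ℤ.neg-distribˡ-* (+ suc m) j) ⟨
    fromℤ (ℤ.- (+ suc m ℤ.* j))      ≈⟨ fromℤ-neg (+ suc m ℤ.* j) ⟩
    - fromℤ (+ suc m ℤ.* j)          ≈⟨ -‿cong (fromℤ-ℕ* (suc m) j) ⟩
    - (fromℕ (suc m) * fromℤ j)      ≈⟨ -‿distribˡ-* (fromℕ (suc m)) (fromℤ j) ⟩
    - fromℕ (suc m) * fromℤ j        ∎

  private
    almostCommutativeRing : AlmostCommutativeRing c ℓ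
    almostCommutativeRing = fromCommutativeRing R

    fromℤ-homomorphism : ℤ.+-*-rawRing -Raw-AlmostCommutative⟶ almostCommutativeRing
    fromℤ-homomorphism = record
      { ⟦_⟧    = fromℤ
      ; +-homo = fromℤ-+
      ; *-homo = fromℤ-*
      ; -‿homo = fromℤ-neg
      ; 0-homo = refl
      ; 1-homo = refl
      }

  module Solver = Algebra.Solver.Ring ℤ.+-*-rawRing almostCommutativeRing fromℤ-homomorphism
    (λ i j → map (λ i≡j → reflexive (≡.cong fromℤ i≡j)) (dec⇒maybe (i ℤ.≟ j)))

-- Minima of finite families in a total order.

module MinimumOf {a ℓ₁ ℓ₂} (O : TotalOrder a ℓ₁ ℓ₂) where

  open TotalOrder O
  open Min O using (_⊓_; x⊓y≤x; x⊓y≤y)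

  -- The same fold as in the convolutions. Over the flipped order it computes to the maximum, so
  -- each fact about it serves for both.
  minimumOf : ∀ {n} → Vector Carrier (suc n) → Carrier
  minimumOf v = foldr _⊓_ (head v) (tail v)

  foldr-≤ε : ∀ {n} ε (v : Vector Carrier n) → foldr _⊓_ ε v ≤ ε
  foldr-≤ε {zero}  ε v = refl
  foldr-≤ε {suc n} ε v = trans (x⊓y≤y (v zero) _) (foldr-≤ε ε (tail v))

  foldr-≤ : ∀ {n} ε (v : Vector Carrier n) i → foldr _⊓_ ε v ≤ v i
  foldr-≤ ε v zero    = x⊓y≤x (v zero) _
  foldr-≤ ε v (suc i) = trans (x⊓y≤y (v zero) _) (foldr-≤ ε (tail v) i)

  -- Stated with `_≡_` rather than the equivalence of the order, because convolution entries are
  -- later compared with memory contents up to `_≡_`.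
  ⊓-select : ∀ x y → x ⊓ y ≡ x ⊎ x ⊓ y ≡ y
  ⊓-select x y with total x y
  ... | inj₁ _ = inj₁ ≡.refl
  ... | inj₂ _ = inj₂ ≡.refl

  foldr-attained : ∀ {n} ε (v : Vector Carrier n) →
                   foldr _⊓_ ε v ≡ ε ⊎ (∃[ i ] foldr _⊓_ ε v ≡ v i)
  foldr-attained {zero}  ε v = inj₁ ≡.refl
  foldr-attained {suc n} ε v with ⊓-select (v zero) (foldr _⊓_ ε (tail v))
  ... | inj₁ eq = inj₂ (zero , eq)
  ... | inj₂ eq with foldr-attained ε (tail v)
  ...   | inj₁ eq′       = inj₁ (≡.trans eq eq′)
  ...   | inj₂ (i , eq′) = inj₂ (suc i , ≡.trans eq eq′)

  minimumOf-≤ : ∀ {n} (v : Vector Carrier (suc n)) i → minimumOf v ≤ v i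
  minimumOf-≤ v zero    = foldr-≤ε (head v) (tail v)
  minimumOf-≤ v (suc i) = foldr-≤ (head v) (tail v) i

  minimumOf-attained : ∀ {n} (v : Vector Carrier (suc n)) → ∃[ i ] minimumOf v ≡ v i
  minimumOf-attained v with foldr-attained (head v) (tail v)
  ... | inj₁ eq       = zero , eq
  ... | inj₂ (i , eq) = suc i , eq

-- Ordered-field arithmetic and the circular distance.

module OrderedField {c ℓ₁ ℓ₂} (R : Reals c ℓ₁ ℓ₂) where

  open Reals R renaming (Carrier to ℝ)
  open OverReals R
  open DecTotalOrder decTotalOrder public
    using (total; antisym; ≤-respˡ-≈; ≤-respʳ-≈)
    renaming (refl to ≤-refl; trans to ≤-trans; reflexive to ≤-reflexive)
  open Algebra.Properties.Ring ring using (+-cancelʳ)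
  open Algebra.Properties.Semiring.Mult.TCOptimised semiring using (1+×)
  open IntegerMultiples commutativeRing public
  open Solver public using (solve; _:=_; _:+_; _:-_; _:*_; :-_; con)
  open Max totalOrder using (x≤x⊔y; x≤y⊔x; ⊔-sel)
  open Min totalOrder using (x⊓y≤x; x⊓y≤y; ⊓-sel)

  ≰⇒≥ : ∀ {a b} → ¬ (a ≤ b) → b ≤ a
  ≰⇒≥ {a} {b} a≰b = [ (λ a≤b → contradiction a≤b a≰b) , (λ b≤a → b≤a) ]′ (total a b)

  ≰⇒> : ∀ {a b} → ¬ (a ≤ b) → b < a
  ≰⇒> a≰b = ≰⇒≥ a≰b , λ b≈a → a≰b (≤-reflexive (sym b≈a))

  <⇒≱ : ∀ {a b} → a < b → ¬ (b ≤ a)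
  <⇒≱ (a≤b , a≉b) b≤a = a≉b (antisym a≤b b≤a)

  infixr 5 _+≤_
  _+≤_ : ∀ {a b p q} → a ≤ b → p ≤ q → a + p ≤ b + q
  _+≤_ {a} {b} {p} {q} a≤b p≤q = ≤-trans (+-monoˡ-≤ p a≤b)
    (≤-respˡ-≈ (+-comm p b) (≤-respʳ-≈ (+-comm q b) (+-monoˡ-≤ b p≤q)))

  -- Linear arithmetic: the side condition, b - a = q - p with no term on the
  -- wrong side, is an identity for the ring solver.
  linear-≤ : ∀ {p q a b} → p ≤ q → a + q ≈ b + p → a ≤ b
  linear-≤ {p} {q} {a} {b} p≤q eq = ≤-respˡ-≈ (cancel a) (≤-respʳ-≈ (cancel b)
    (+-monoˡ-≤ (- q) (≤-respˡ-≈ (sym eq) (≤-refl +≤ p≤q))))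
    where
    cancel : ∀ z → z + q - q ≈ z
    cancel z = solve 2 (λ z q → z :+ q :- q := z) refl z q

  linear-≈ : ∀ {p q a b} → p ≈ q → a + q ≈ b + p → a ≈ b
  linear-≈ {p} {q} {a} {b} p≈q eq = +-cancelʳ q a b (trans eq (+-congˡ p≈q))

  double-cancel-≤ : ∀ {a b} → a + a ≤ b + b → a ≤ b
  double-cancel-≤ {a} {b} aa≤bb = [ (λ a≤b → a≤b) , from-≥ ]′ (total a b)
    where
    from-≥ : b ≤ a → a ≤ b
    from-≥ b≤a = linear-≤ (aa≤bb +≤ b≤a)
      (solve 2 (λ a b → a :+ (b :+ b :+ a) := b :+ (a :+ a :+ b)) refl a b)

  0≤1 : 0# ≤ 1#
  0≤1 = [ (λ 0≤1 → 0≤1) , (λ 1≤0 → let 0≤-1 = 0≤-1 1≤0 in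
          ≤-respʳ-≈ (solve 0 (con (-[1+ 0 ]) :* con (-[1+ 0 ]) := con (+ 1)) refl)
            (*-nonNeg 0≤-1 0≤-1)) ]′ (total 0# 1#)
    where
    0≤-1 : 1# ≤ 0# → 0# ≤ - 1#
    0≤-1 1≤0 = linear-≤ 1≤0 (solve 0 (con (+ 0) :+ con (+ 0) := con (-[1+ 0 ]) :+ con (+ 1)) refl)

  1≰0 : ¬ (1# ≤ 0#)
  1≰0 1≤0 = 1≉0 (antisym 1≤0 0≤1)

  2≉0 : ¬ (1# + 1# ≈ 0#)
  2≉0 2≈0 = 1≰0 (linear-≤ (≤-reflexive 2≈0 +≤ 0≤1)
    (solve 0 (con (+ 1) :+ (con (+ 0) :+ con (+ 1)) := con (+ 0) :+ (con (+ 2) :+ con (+ 0))) refl))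

  -- Multiplication by an inverse is how the machine evaluates `_⊘_`, so this is literally the
  -- stored quotient.
  half : ℝ → ℝ
  half u = u * (1# + 1#) ⁻¹

  half+half : ∀ u → half u + half u ≈ u
  half+half u = begin
    half u + half u              ≈⟨ solve 2 (λ u h → u :* h :+ u :* h := u :* (con (+ 2) :* h)) refl u _ ⟩
    u * ((1# + 1#) * (1# + 1#) ⁻¹) ≈⟨ *-congˡ (*-inverseʳ (1# + 1#) 2≉0) ⟩
    u * 1#                       ≈⟨ *-identityʳ u ⟩
    u                            ∎
    where open Relation.Binary.Reasoning.Setoid setoid

  fromℕ-suc : ∀ n → fromℕ (suc n) ≈ 1# + fromℕ n
  fromℕ-suc n = 1+× n 1#

  0≤fromℕ : ∀ n → 0# ≤ fromℕ n
  0≤fromℕ zero    = ≤-refl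
  0≤fromℕ (suc n) = ≤-respʳ-≈ (sym (fromℕ-suc n)) (≤-respˡ-≈ (+-identityˡ 0#) (0≤1 +≤ 0≤fromℕ n))

  1≤fromℕ : ∀ n → 1# ≤ fromℕ (suc n)
  1≤fromℕ n = ≤-respʳ-≈ (sym (fromℕ-suc n)) (≤-respˡ-≈ (+-identityʳ 1#) (≤-refl {1#} +≤ 0≤fromℕ n))

  -- ∣ u - v ∣ ≤ D, with u and v moved so that no subtraction occurs.
  Close : ℝ → ℝ → ℝ → Set ℓ₂
  Close D u v = u ≤ v + D × v ≤ u + D

  -- Closeness depends only on the difference of the two points, and the equation says that both
  -- pairs have the same one. Changes of representative modulo whole turns go through this lemma.
  Close-shift : ∀ {D u v u′ v′} → u′ + v ≈ v′ + u → Close D u v → Close D u′ v′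
  Close-shift {D} {u} {v} {u′} {v′} eq (u≤ , v≤) =
    linear-≤ u≤ (linear-≈ eq (solve 5 (λ D u v u′ v′ →
      u′ :+ (v :+ D) :+ (v′ :+ u) := v′ :+ D :+ u :+ (u′ :+ v)) refl D u v u′ v′)) ,
    linear-≤ v≤ (linear-≈ (sym eq) (solve 5 (λ D u v u′ v′ →
      v′ :+ (u :+ D) :+ (u′ :+ v) := u′ :+ D :+ v :+ (v′ :+ u)) refl D u v u′ v′))

  -- A translate by zero bounds the first argument of the minimum in `d°`. A translate by at least
  -- one turn bounds the second: upwards through `a - b ≤ ∣ a - b ∣`, downwards through
  -- `- (a - b) ≤ ∣ a - b ∣`.
  d°≤-shifted : ∀ {a b V} z → Close V a (b + fromℤ z) → d° a b ≤ V
  d°≤-shifted {a} {b} {V} (+ 0) (a≤ , ≤a) =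
    ≤-trans (x⊓y≤x ∣ a - b ∣ _) ([ below a-b≤V , below b-a≤V ]′ (⊔-sel (a - b) (- (a - b))))
    where
    below : ∀ {u} → u ≤ V → ∣ a - b ∣ ≈ u → ∣ a - b ∣ ≤ V
    below u≤V eq = ≤-respˡ-≈ (sym eq) u≤V
    a-b≤V : a - b ≤ V
    a-b≤V = linear-≤ a≤ (solve 3 (λ a b V → a :- b :+ (b :+ con (+ 0) :+ V) := V :+ a) refl a b V)
    b-a≤V : - (a - b) ≤ V
    b-a≤V = linear-≤ ≤a (solve 3 (λ a b V → :- (a :- b) :+ (a :+ V) := V :+ (b :+ con (+ 0))) refl a b V)
  d°≤-shifted {a} {b} {V} (+ suc m) (_ , ≤a) = ≤-trans (x⊓y≤y ∣ a - b ∣ _)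
    (linear-≤ (≤a +≤ x≤x⊔y (a - b) (- (a - b)) +≤ 1≤fromℕ m)
      (solve 5 (λ a b V s k → con (+ 1) :- s :+ (a :+ V :+ (s :+ k)) := V :+ (b :+ k :+ (a :- b :+ con (+ 1))))
        refl a b V ∣ a - b ∣ (fromℕ (suc m))))
  d°≤-shifted {a} {b} {V} -[1+ m ] (a≤ , _) = ≤-trans (x⊓y≤y ∣ a - b ∣ _)
    (linear-≤ (a≤ +≤ x≤y⊔x (a - b) (- (a - b)) +≤ 1≤fromℕ m)
      (solve 5 (λ a b V s k → con (+ 1) :- s :+ (b :- k :+ V :+ (s :+ k)) := V :+ (a :+ (:- (a :- b) :+ con (+ 1))))
        refl a b V ∣ a - b ∣ (fromℕ (suc m))))

  module _ {a b : ℝ} (a∈ : InUnit a) (b∈ : InUnit b) where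

    ∣a-b∣≤1 : ∣ a - b ∣ ≤ 1#
    ∣a-b∣≤1 = [ (λ eq → ≤-respˡ-≈ (sym eq) a-b≤1) , (λ eq → ≤-respˡ-≈ (sym eq) b-a≤1) ]′
              (⊔-sel (a - b) (- (a - b)))
      where
      a-b≤1 : a - b ≤ 1#
      a-b≤1 = linear-≤ (proj₁ (proj₂ a∈) +≤ proj₁ b∈)
        (solve 2 (λ a b → a :- b :+ (con (+ 1) :+ b) := con (+ 1) :+ (a :+ con (+ 0))) refl a b)
      b-a≤1 : - (a - b) ≤ 1#
      b-a≤1 = linear-≤ (proj₁ (proj₂ b∈) +≤ proj₁ a∈)
        (solve 2 (λ a b → :- (a :- b) :+ (con (+ 1) :+ a) := con (+ 1) :+ (b :+ con (+ 0))) refl a b)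

    0≤∣a-b∣ : 0# ≤ ∣ a - b ∣
    0≤∣a-b∣ = double-cancel-≤ (linear-≤ (x≤x⊔y (a - b) (- (a - b)) +≤ x≤y⊔x (a - b) (- (a - b)))
      (solve 3 (λ a b s → con (+ 0) :+ con (+ 0) :+ (s :+ s) := s :+ s :+ (a :- b :+ :- (a :- b)))
        refl a b ∣ a - b ∣))

    0≤d° : 0# ≤ d° a b
    0≤d° = [ (λ eq → ≤-respʳ-≈ (sym eq) 0≤∣a-b∣)
           , (λ eq → ≤-respʳ-≈ (sym eq) (linear-≤ ∣a-b∣≤1
               (solve 1 (λ s → con (+ 0) :+ con (+ 1) := con (+ 1) :- s :+ s) refl ∣ a - b ∣))) ]′
           (⊓-sel ∣ a - b ∣ (1# - ∣ a - b ∣))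

    d°≤1 : d° a b ≤ 1#
    d°≤1 = ≤-trans (x⊓y≤x ∣ a - b ∣ _) ∣a-b∣≤1

    -- The extra turn of a makes w a natural number.
    d°-unwrap : ∀ {D} → d° a b ≤ D → ∃[ w ] Close D (a + 1#) (b + fromℕ w)
    d°-unwrap {D} d≤D = [ direct , around ]′ (⊓-sel s (1# - s))
      where
      s : ℝ
      s = ∣ a - b ∣

      direct : d° a b ≈ s → ∃[ w ] Close D (a + 1#) (b + fromℕ w)
      direct eq = 1 ,
        linear-≤ (s≤D +≤ x≤x⊔y (a - b) (- (a - b)))
          (solve 4 (λ a b s D → a :+ con (+ 1) :+ (D :+ s) := b :+ con (+ 1) :+ D :+ (s :+ (a :- b))) refl a b s D) ,
        linear-≤ (s≤D +≤ x≤y⊔x (a - b) (- (a - b)))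
          (solve 4 (λ a b s D → b :+ con (+ 1) :+ (D :+ s) := a :+ con (+ 1) :+ D :+ (s :+ :- (a :- b))) refl a b s D)
        where
        s≤D : s ≤ D
        s≤D = ≤-respˡ-≈ eq d≤D

      around : d° a b ≈ 1# - s → ∃[ w ] Close D (a + 1#) (b + fromℕ w)
      around eq = [ up , down ]′ (⊔-sel (a - b) (- (a - b)))
        where
        1-s≤D : 1# - s ≤ D
        1-s≤D = ≤-respˡ-≈ eq d≤D
        up : s ≈ a - b → ∃[ w ] Close D (a + 1#) (b + fromℕ w)
        up s≈ = 2 ,
          -- The bound `s ≤ 1#` enters twice: for `s - 1# ≤ 0#`, and for `0# ≤ 1# - s`, which is at
          -- most `D`.
          linear-≤ (1-s≤D +≤ ∣a-b∣≤1 +≤ ∣a-b∣≤1 +≤ ≤-reflexive (sym s≈))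
            (solve 4 (λ a b s D → a :+ con (+ 1) :+ (D :+ (con (+ 1) :+ (con (+ 1) :+ s)))
              := b :+ con (+ 2) :+ D :+ (con (+ 1) :- s :+ (s :+ (s :+ (a :- b))))) refl a b s D) ,
          linear-≤ (1-s≤D +≤ ≤-reflexive s≈)
            (solve 4 (λ a b s D → b :+ con (+ 2) :+ (D :+ (a :- b))
              := a :+ con (+ 1) :+ D :+ (con (+ 1) :- s :+ s)) refl a b s D)
        down : s ≈ - (a - b) → ∃[ w ] Close D (a + 1#) (b + fromℕ w)
        down s≈ = 0 ,
          linear-≤ (1-s≤D +≤ ≤-reflexive s≈)
            (solve 4 (λ a b s D → a :+ con (+ 1) :+ (D :+ :- (a :- b))
              := b :+ con (+ 0) :+ D :+ (con (+ 1) :- s :+ s)) refl a b s D) ,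
          linear-≤ (1-s≤D +≤ ∣a-b∣≤1 +≤ ∣a-b∣≤1 +≤ ≤-reflexive (sym s≈))
            (solve 4 (λ a b s D → b :+ con (+ 0) :+ (D :+ (con (+ 1) :+ (con (+ 1) :+ s)))
              := a :+ con (+ 1) :+ D :+ (con (+ 1) :- s :+ (s :+ (s :+ :- (a :- b))))) refl a b s D)

-- Pigeonhole principle and residues modulo `n`.

no-squeeze : ∀ {f : ℕ → ℕ} → Injective _≡_ _≡_ f → ∀ a b d →
             ¬ (∀ i → i ℕ.≤ d → b ℕ.≤ f (a ℕ.+ i) × f (a ℕ.+ i) ℕ.< b ℕ.+ d)
no-squeeze {f} f-injective a b d bounds = collision (Fin.pigeonhole (ℕ.n<1+n d) g)
  where
  bound : (i : Fin (suc d)) → b ℕ.≤ f (a ℕ.+ toℕ i) × f (a ℕ.+ toℕ i) ℕ.< b ℕ.+ d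
  bound i = bounds (toℕ i) (ℕ.≤-pred (Fin.toℕ<n i))
  -- Subtracting `b`, which is injective on numbers from `b` on, puts `d + 1` arguments into `d`
  -- pigeonholes.
  below : (i : Fin (suc d)) → f (a ℕ.+ toℕ i) ℕ.∸ b ℕ.< d
  below i = ≡.subst (f (a ℕ.+ toℕ i) ℕ.∸ b ℕ.<_) (ℕ.m+n∸m≡n b d) (ℕ.∸-monoˡ-< (proj₂ (bound i)) (proj₁ (bound i)))
  g : Fin (suc d) → Fin d
  g i = fromℕ< (below i)
  collision : ¬ (∃[ i ] ∃[ j ] i Fin.< j × g i ≡ g j)
  collision (i , j , i<j , gi≡gj) = ℕ.<⇒≢ i<j (ℕ.+-cancelˡ-≡ a _ _ (f-injective
    (ℕ.∸-cancelʳ-≡ (proj₁ (bound i)) (proj₁ (bound j)) (Fin.fromℕ<-injective _ _ (below i) (below j) gi≡gj))))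

module Residues {n : ℕ} .{{_ : NonZero n}} where

  mod-≡ : ∀ {j k} → j % n ≡ k % n → j mod n ≡ k mod n
  mod-≡ {j} {k} eq = Fin.fromℕ<-cong _ _ eq (m%n<n j n) (m%n<n k n)

  toℕ-mod : ∀ j → toℕ (j mod n) ≡ j % n
  toℕ-mod j = Fin.toℕ-fromℕ< (m%n<n j n)

  mod-toℕ : ∀ (r : Fin n) → toℕ r mod n ≡ r
  mod-toℕ r = Fin.toℕ-injective (≡.trans (toℕ-mod (toℕ r)) (m<n⇒m%n≡m (Fin.toℕ<n r)))

  mod-+* : ∀ j k → (j ℕ.+ k ℕ.* n) mod n ≡ j mod n
  mod-+* j k = mod-≡ ([m+kn]%n≡m%n j k n)

  /-+* : ∀ j k → (j ℕ.+ k ℕ.* n) / n ≡ j / n ℕ.+ k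
  /-+* j k = ≡.trans (+-distrib-/-∣ʳ j (divides-refl k)) (≡.cong (j / n ℕ.+_) (m*n/n≡m k n))

  mod-decompose : ∀ j → j ≡ toℕ (j mod n) ℕ.+ j / n ℕ.* n
  mod-decompose j = ≡.trans (m≡m%n+[m/n]*n j n) (≡.cong (ℕ._+ j / n ℕ.* n) (≡.sym (toℕ-mod j)))

  -- The multiplier depends only on `i mod n`, so the map commutes with whole turns, as a matching
  -- lifted from the circle must.
  permuted : ℕ → (Fin n → ℕ) → ℕ → ℕ
  permuted s m i = i ℕ.+ s ℕ.+ m (i mod n) ℕ.* n

  -- Modulo `n` the value is `i + s`. Equal values thus have arguments with equal residues, hence
  -- equal multipliers, and cancellation finishes.
  permuted-injective : ∀ s m → Injective _≡_ _≡_ (permuted s m)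
  permuted-injective s m {i} {j} eq = ℕ.+-cancelʳ-≡ s i j (ℕ.+-cancelʳ-≡ (m (i mod n) ℕ.* n) (i ℕ.+ s) (j ℕ.+ s)
      (≡.trans eq (≡.cong (λ r → j ℕ.+ s ℕ.+ m r ℕ.* n) (≡.sym residues))))
    where
    swap : ∀ i → permuted s m i ≡ i ℕ.+ m (i mod n) ℕ.* n ℕ.+ s
    swap i = +-*-Solver.solve 3 (λ i s k → i :+ s :+ k := i :+ k :+ s) ≡.refl i s (m (i mod n) ℕ.* n)
      where open +-*-Solver using (_:=_; _:+_)
    residues : i mod n ≡ j mod n
    residues = ≡.trans (≡.sym (mod-+* i (m (i mod n)))) (≡.trans
      (≡.cong (_mod n) (ℕ.+-cancelʳ-≡ s _ _ (≡.trans (≡.sym (swap i)) (≡.trans eq (swap j)))))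
      (mod-+* j (m (j mod n))))

-- Unrolling necklaces onto the line.

module Necklaces {c ℓ₁ ℓ₂} (R : Reals c ℓ₁ ℓ₂) {n : ℕ} .{{n≢0 : NonZero n}} where

  open Reals R renaming (Carrier to ℝ)
  open OverReals R
  open OrderedField R
  open Residues {n}
  open Algebra.Properties.Semiring.Mult.TCOptimised semiring using (×-homo-+)
  private module ⊔ᴿ = MinimumOf (flip totalOrder)

  unroll : Vector ℝ n → ℕ → ℝ
  unroll x j = x (j mod n) + fromℕ (j / n)

  unroll-≡ : ∀ x {j q} {r : Fin n} → j mod n ≡ r → j / n ≡ q → unroll x j ≡ x r + fromℕ q
  unroll-≡ x ≡.refl ≡.refl = ≡.refl

  unroll-toℕ : ∀ x r → unroll x (toℕ r) ≈ x r
  unroll-toℕ x r = trans (reflexive (unroll-≡ x (mod-toℕ r) (m<n⇒m/n≡0 (Fin.toℕ<n r)))) (+-identityʳ (x r))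

  unroll-+* : ∀ x j k → unroll x (j ℕ.+ k ℕ.* n) ≈ unroll x j + fromℕ k
  unroll-+* x j k = trans (reflexive (unroll-≡ x (mod-+* j k) (/-+* j k)))
    (trans (+-congˡ (×-homo-+ 1# (j / n) k)) (sym (+-assoc _ _ _)))

  maximum-≥ : ∀ {k} .{{_ : NonZero k}} (v : Vector ℝ k) i → v i ≤ maximum v
  maximum-≥ {suc k} v i = ⊔ᴿ.minimumOf-≤ v i

  maximum-attained : ∀ {k} .{{_ : NonZero k}} (v : Vector ℝ k) → ∃[ i ] maximum v ≡ v i
  maximum-attained {suc k} v = ⊔ᴿ.minimumOf-attained v

  fromℕ-mono : ∀ {p q} → p ℕ.≤ q → fromℕ p ≤ fromℕ q
  fromℕ-mono {p} {q} p≤q = ≤-respʳ-≈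
    (trans (sym (×-homo-+ 1# p (q ℕ.∸ p))) (reflexive (≡.cong fromℕ (ℕ.m+[n∸m]≡n p≤q))))
    (≤-respˡ-≈ (+-identityʳ (fromℕ p)) (≤-refl +≤ 0≤fromℕ (q ℕ.∸ p)))

  module _ {x : Vector ℝ n} (x-necklace : IsNecklace x) where

    open IsNecklace x-necklace

    0≤bead : ∀ r → 0# ≤ x r
    0≤bead r = proj₁ (inUnit r)

    bead≤1 : ∀ r → x r ≤ 1#
    bead≤1 r = proj₁ (proj₂ (inUnit r))

    unroll-mono : ∀ {i j} → i ℕ.≤ j → unroll x i ≤ unroll x j
    unroll-mono {i} {j} i≤j with ℕ.m≤n⇒m<n∨m≡n (/-monoˡ-≤ n i≤j)
    ... | inj₂ i/n≡j/n = sorted _ _ residues +≤ ≤-reflexive (reflexive (≡.cong fromℕ i/n≡j/n))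
      where
      residues : i mod n Fin.≤ j mod n
      residues = ℕ.+-cancelʳ-≤ (i / n ℕ.* n) _ _ (≡.subst₂ ℕ._≤_ (mod-decompose i)
        (≡.trans (mod-decompose j) (≡.cong (λ q → toℕ (j mod n) ℕ.+ q ℕ.* n) (≡.sym i/n≡j/n))) i≤j)
    -- Across different turns sortedness says nothing, but a bead is at most one and the later
    -- position is at least one turn ahead.
    ... | inj₁ i/n<j/n = linear-≤
      (bead≤1 (i mod n) +≤ 0≤bead (j mod n) +≤ fromℕ-mono i/n<j/n +≤ ≤-reflexive (sym (fromℕ-suc (i / n))))
      (solve 5 (λ a b p p′ q → a :+ p :+ (con (+ 1) :+ (b :+ (q :+ p′)))
        := b :+ q :+ (a :+ (con (+ 0) :+ (p′ :+ (con (+ 1) :+ p))))) refl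
        (x (i mod n)) (x (j mod n)) (fromℕ (i / n)) (fromℕ (suc (i / n))) (fromℕ (j / n)))

  -- From a bijection of beads to a shift.

  module _ {x y : Vector ℝ n} (x-necklace : IsNecklace x) (y-necklace : IsNecklace y) where

    private
      X Y : ℕ → ℝ
      X = unroll x
      Y = unroll y

    -- A bijection i ↦ i + s + m i · n of the beads moving no bead by more than
    -- D can be replaced by a shift.  Let P t say that Y (i + t) never exceeds
    -- its partner by more than D, and Q t the converse.  P holds for t = 0 and
    -- fails for large t; if it fails at t + 1 for some i₀, and Q fails at t for
    -- some i₁ ≤ i₀, then the bijection squeezes [i₁, i₀] into a shorter interval.
    -- The two turns added to x let m and t be natural numbers.
    module _ {D o : ℝ} (0≤D : 0# ≤ D) (D≤1 : D ≤ 1#) (0≤o : 0# ≤ o) (o≤1 : o ≤ 1#)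
             (s : ℕ) (m : Fin n → ℕ)
             (close : ∀ r → Close D (x r + o + (1# + 1#)) (Y (toℕ r ℕ.+ s ℕ.+ m r ℕ.* n))) where

      private
        X′ : ℕ → ℝ
        X′ i = X i + o + (1# + 1#)

        f : ℕ → ℕ
        f = permuted s m

        X′-mono : ∀ {i j} → i ℕ.≤ j → X′ i ≤ X′ j
        X′-mono i≤j = +-monoˡ-≤ _ (+-monoˡ-≤ o (unroll-mono x-necklace i≤j))

        Y-mono : ∀ {i j} → i ℕ.≤ j → Y i ≤ Y j
        Y-mono = unroll-mono y-necklace

        Y-f : ∀ i → let r = i mod n in Y (f i) ≈ Y (toℕ r ℕ.+ s ℕ.+ m r ℕ.* n) + fromℕ (i / n)
        Y-f i = trans (reflexive (≡.cong Y (≡.trans (≡.cong (λ i → i ℕ.+ s ℕ.+ m r ℕ.* n) (mod-decompose i))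
            (+-*-Solver.solve 4 (λ r q s k → r :+′ q :+′ s :+′ k :=′ r :+′ s :+′ k :+′ q) ≡.refl
              (toℕ r) (i / n ℕ.* n) s (m r ℕ.* n)))))
          (unroll-+* y _ (i / n))
          where
          r = i mod n
          open +-*-Solver using () renaming (_:+_ to _:+′_; _:=_ to _:=′_)

        close-f : ∀ i → Close D (X′ i) (Y (f i))
        close-f i = Close-shift (linear-≈ (sym (Y-f i))
          (solve 5 (λ x q o y yf → x :+ q :+ o :+ con (+ 2) :+ y :+ yf
            := yf :+ (x :+ o :+ con (+ 2)) :+ (y :+ q)) refl
            (x (i mod n)) (fromℕ (i / n)) o _ (Y (f i)))) (close (i mod n))

        P Q : ℕ → Set ℓ₂
        P t = ∀ i → Y (i ℕ.+ t) ≤ X′ i + D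
        Q t = ∀ i → X′ i ≤ Y (i ℕ.+ t) + D

        P-zero : P 0
        P-zero i = linear-≤ (≤-reflexive (reflexive (≡.cong Y (ℕ.+-identityʳ i))) +≤ bead≤1 y-necklace (i mod n)
            +≤ 0≤bead x-necklace (i mod n) +≤ 0≤o +≤ 0≤D +≤ 0≤1)
          (solve 6 (λ y′ y x q o D → y′ :+ (y :+ q :+ (con (+ 1) :+ (x :+ (o :+ (D :+ con (+ 1))))))
            := x :+ q :+ o :+ con (+ 2) :+ D :+ (y′ :+ (y :+ (con (+ 0) :+ (con (+ 0) :+ (con (+ 0) :+ con (+ 0))))))) refl
            (Y (i ℕ.+ 0)) (y (i mod n)) (x (i mod n)) (fromℕ (i / n)) o D)

        -- Six turns are enough, as `X′ 0 + D` is at most 5: one each for the bead, the offset and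
        -- `D`, and the two added turns.
        ¬P-large : ¬ P (6 ℕ.* n)
        ¬P-large p = 1≰0 (linear-≤
          (p 0 +≤ ≤-reflexive (sym (unroll-+* y 0 6)) +≤ ≤-reflexive (reflexive (≡.cong fromℕ (0/n≡0 n)))
            +≤ bead≤1 x-necklace (0 mod n) +≤ 0≤bead y-necklace (0 mod n) +≤ 0≤fromℕ (0 / n) +≤ o≤1 +≤ D≤1)
          (solve 6 (λ y′ y x q o D → con (+ 1) :+ (x :+ q :+ o :+ con (+ 2) :+ D :+ (y′
              :+ (con (+ 0) :+ (con (+ 1) :+ (y :+ (q :+ (con (+ 1) :+ con (+ 1))))))))
            := con (+ 0) :+ (y′ :+ (y :+ q :+ con (+ 6) :+ (q :+ (x :+ (con (+ 0) :+ (con (+ 0) :+ (o :+ D)))))))) refl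
            (Y (6 ℕ.* n)) (y (0 mod n)) (x (0 mod n)) (fromℕ (0 / n)) o D))

        P-suc : ∀ {t} → ¬ Q t → P (suc t)
        P-suc {t} ¬Q i₀ = decidable-stable (_ ≤? _) λ ¬P → ¬Q λ i₁ → decidable-stable (_ ≤? _) (squeezed ¬P i₁)
          where
          squeezed : ¬ (Y (i₀ ℕ.+ suc t) ≤ X′ i₀ + D) → ∀ i₁ → ¬ ¬ (X′ i₁ ≤ Y (i₁ ℕ.+ t) + D)
          squeezed ¬P i₁ ¬Q = no-squeeze (permuted-injective s m) i₁ (suc (i₁ ℕ.+ t)) d bounds
            where
            i₂ d : ℕ
            -- The failure of `P` at `i₀` recurs after whole turns. Adding `i₁` of them ensures
            -- `i₁ ≤ i₂`, since `n` is at least one.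
            i₂ = i₀ ℕ.+ i₁ ℕ.* n
            d  = i₂ ℕ.∸ i₁

            i₁+d≡i₂ : i₁ ℕ.+ d ≡ i₂
            i₁+d≡i₂ = ℕ.m+[n∸m]≡n (ℕ.≤-trans (ℕ.m≤m*n i₁ n) (ℕ.m≤n+m (i₁ ℕ.* n) i₀))

            ¬P₂ : ¬ (Y (i₂ ℕ.+ suc t) ≤ X′ i₂ + D)
            ¬P₂ p = ¬P (linear-≤ (p +≤ ≤-reflexive (sym Y-eq) +≤ ≤-reflexive (unroll-+* x i₀ i₁))
              (solve 7 (λ y₂ y₀ x₂ x₀ o D q → y₀ :+ (x₂ :+ o :+ con (+ 2) :+ D :+ (y₂ :+ (x₀ :+ q)))
                := x₀ :+ o :+ con (+ 2) :+ D :+ (y₂ :+ (y₀ :+ q :+ x₂))) refl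
                (Y (i₂ ℕ.+ suc t)) (Y (i₀ ℕ.+ suc t)) (X i₂) (X i₀) o D (fromℕ i₁)))
              where
              Y-eq : Y (i₂ ℕ.+ suc t) ≈ Y (i₀ ℕ.+ suc t) + fromℕ i₁
              Y-eq = trans (reflexive (≡.cong Y (+-*-Solver.solve 3 (λ i k t → i :+′ k :+′ t :=′ i :+′ t :+′ k)
                ≡.refl i₀ (i₁ ℕ.* n) (suc t)))) (unroll-+* y (i₀ ℕ.+ suc t) i₁)
                where open +-*-Solver using () renaming (_:+_ to _:+′_; _:=_ to _:=′_)

            end : suc (i₁ ℕ.+ t) ℕ.+ d ≡ i₂ ℕ.+ suc t
            end = ≡.trans (+-*-Solver.solve 3 (λ i t d → con′ 1 :+′ (i :+′ t) :+′ d :=′ i :+′ d :+′ (con′ 1 :+′ t))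
                ≡.refl i₁ t d) (≡.cong (ℕ._+ suc t) i₁+d≡i₂)
              where open +-*-Solver using () renaming (_:+_ to _:+′_; _:=_ to _:=′_; con to con′)

            bounds : ∀ i → i ℕ.≤ d → suc (i₁ ℕ.+ t) ℕ.≤ f (i₁ ℕ.+ i) × f (i₁ ℕ.+ i) ℕ.< suc (i₁ ℕ.+ t) ℕ.+ d
            -- By monotonicity, an image at or below `i₁ + t` would yield the inequality of `Q` at
            -- `i₁`, and one at or above `i₂ + suc t` that of `P` at `i₂`. This leaves `d` images
            -- for `d + 1` arguments.
            bounds i i≤d =
              ℕ.≰⇒> (λ f≤ → ¬Q (≤-trans (X′-mono (ℕ.m≤m+n i₁ i))
                (≤-trans (proj₁ (close-f (i₁ ℕ.+ i))) (+-monoˡ-≤ D (Y-mono f≤))))) ,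
              ℕ.≰⇒> (λ ≤f → ¬P₂ (≤-trans (Y-mono (≡.subst (ℕ._≤ f (i₁ ℕ.+ i)) end ≤f))
                (≤-trans (proj₂ (close-f (i₁ ℕ.+ i))) (+-monoˡ-≤ D (X′-mono
                  (≡.subst (i₁ ℕ.+ i ℕ.≤_) i₁+d≡i₂ (ℕ.+-monoʳ-≤ i₁ i≤d)))))))

      -- `Q` must hold at some shift where `P` does: otherwise `P-suc` would carry `P` all the way
      -- up to `6 ℕ.* n`. Such a shift is not computed, since `P` and `Q` are not decided.
      shift-exists : ¬ (∀ t → ¬ (∀ i → Close D (X′ i) (Y (i ℕ.+ t))))
      shift-exists none = ¬P-large (P-all (6 ℕ.* n))
        where
        P-all : ∀ t → P t
        P-all zero    = P-zero
        P-all (suc t) = P-suc λ q → none t λ i → q i , P-all t i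

  -- Gaps, their midpoint and optimality.

  gap : Vector ℝ n → Vector ℝ n → Fin n → ℕ → ℝ
  gap x y r t = x r - unroll y (toℕ r ℕ.+ t)

  record Extremes (x y : Vector ℝ n) (t : ℕ) (lo hi : ℝ) : Set (c Level.⊔ ℓ₁ Level.⊔ ℓ₂) where
    field
      lo-≤        : ∀ r → lo ≤ gap x y r t
      ≤-hi        : ∀ r → gap x y r t ≤ hi
      lo-attained : ∃[ r ] lo ≡ gap x y r t
      hi-attained : ∃[ r ] hi ≡ gap x y r t

  -- The offset has to cancel the midpoint of the gaps, hence the sign. The form of the expression
  -- is literally what `recover-result` computes.
  centre : ℝ → ℝ → ℝ
  centre lo hi = half (0# - (hi + lo))

  centre+centre : ∀ lo hi → centre lo hi + centre lo hi ≈ 0# - (hi + lo)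
  centre+centre lo hi = half+half (0# - (hi + lo))

  module _ {x y : Vector ℝ n} (x-necklace : IsNecklace x) (y-necklace : IsNecklace y) where

    private
      X Y : ℕ → ℝ
      X = unroll x
      Y = unroll y

    /n≤1 : ∀ (r : Fin n) {t} → t ℕ.< n → (toℕ r ℕ.+ t) / n ℕ.≤ 1
    /n≤1 r {t} t<n = ℕ.≤-pred (m<n*o⇒m/o<n (ℕ.+-mono-≤ (Fin.toℕ<n r)
      (≡.subst (t ℕ.≤_) (≡.sym (ℕ.+-identityʳ n)) (ℕ.<⇒≤ t<n))))

    moved : ∀ {o} → InUnit o → ∀ r →
            InUnit ((x r + o) mod1) × ((x r + o) mod1 ≈ x r + o ⊎ (x r + o) mod1 + 1# ≈ x r + o)
    moved {o} (0≤o , o≤1 , _) r = mod1-inUnit (x r + o)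
      (≤-respˡ-≈ (+-identityˡ 0#) (0≤bead x-necklace r +≤ 0≤o))
      (≰⇒> λ 2≤x+o → <⇒≱ (proj₂ (IsNecklace.inUnit x-necklace r)) (linear-≤ (2≤x+o +≤ o≤1)
        (solve 2 (λ x o → con (+ 1) :+ (x :+ o :+ con (+ 1)) := x :+ (con (+ 2) :+ o)) refl (x r) o)))

    module _ {o : ℝ} (o∈ : InUnit o) (s : Fin n) where

      private
        D : ℝ
        D = distance x y o s
        a b : Fin n → ℝ
        a r = (x r + o) mod1
        b r = y ((toℕ r ℕ.+ toℕ s) mod n)
        b∈ : ∀ r → InUnit (b r)
        b∈ r = IsNecklace.inUnit y-necklace _

      d°≤distance : ∀ r → d° (a r) (b r) ≤ D
      d°≤distance = maximum-≥ (λ r → d° (a r) (b r))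

      0≤distance : 0# ≤ D
      -- Any bead will do; `s` supplies one.
      0≤distance = ≤-trans (0≤d° (proj₁ (moved o∈ s)) (b∈ s)) (d°≤distance s)

      distance≤1 : D ≤ 1#
      distance≤1 = let r , eq = maximum-attained (λ r → d° (a r) (b r)) in
        ≤-respˡ-≈ (reflexive (≡.sym eq)) (d°≤1 (proj₁ (moved o∈ r)) (b∈ r))

      -- If `_mod1` dropped a turn of `x r + o`, that turn is added to `w`.
      unmod : ∀ r → ∃[ w ] Close D (x r + o + 1#) (b r + fromℕ w)
      unmod r = from (d°-unwrap (proj₁ (moved o∈ r)) (b∈ r) (d°≤distance r)) (proj₂ (moved o∈ r))
        where
        from : ∃[ w ] Close D (a r + 1#) (b r + fromℕ w) → (a r ≈ x r + o ⊎ a r + 1# ≈ x r + o) →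
               ∃[ w ] Close D (x r + o + 1#) (b r + fromℕ w)
        from (w , close) (inj₁ a≈) = w , Close-shift (linear-≈ (sym a≈)
          (solve 4 (λ a xo b w → xo :+ con (+ 1) :+ (b :+ w) :+ a := b :+ w :+ (a :+ con (+ 1)) :+ xo)
            refl (a r) (x r + o) (b r) (fromℕ w))) close
        from (w , close) (inj₂ a≈) = suc w , Close-shift (linear-≈ (+-cong (sym a≈) (sym (fromℕ-suc w)))
          (solve 5 (λ a xo b w w′ → xo :+ con (+ 1) :+ (b :+ w) :+ (a :+ con (+ 1) :+ w′)
              := b :+ w′ :+ (a :+ con (+ 1)) :+ (xo :+ (con (+ 1) :+ w)))
            refl (a r) (x r + o) (b r) (fromℕ w) (fromℕ (suc w)))) close

      -- Position `k` of the unrolled `y` is already `q ≤ 1` turns ahead of `b r`, so `w + 1 - q`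
      -- further turns are needed. The second turn added to `x r + o` keeps this number natural.
      near : ∀ r → ∃[ m ] Close D (x r + o + (1# + 1#)) (Y (toℕ r ℕ.+ toℕ s ℕ.+ m ℕ.* n))
      near r = from (unmod r)
        where
        k q : ℕ
        k = toℕ r ℕ.+ toℕ s
        q = k / n
        total-turns : ∀ w → fromℕ w + 1# ≈ fromℕ (w ℕ.+ (1 ℕ.∸ q)) + fromℕ q
        total-turns w = trans (sym (×-homo-+ 1# w 1)) (trans (reflexive (≡.cong fromℕ
          (≡.trans (≡.cong (w ℕ.+_) (≡.sym (ℕ.m∸n+n≡m (/n≤1 r (Fin.toℕ<n s))))) (≡.sym (ℕ.+-assoc w (1 ℕ.∸ q) q)))))
          (×-homo-+ 1# (w ℕ.+ (1 ℕ.∸ q)) q))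
        from : ∃[ w ] Close D (x r + o + 1#) (b r + fromℕ w) →
               ∃[ m ] Close D (x r + o + (1# + 1#)) (Y (k ℕ.+ m ℕ.* n))
        from (w , close) = m , Close-shift
          (linear-≈ (+-cong (sym (unroll-+* y k m)) (total-turns w))
            (solve 6 (λ xo b w m q y → xo :+ con (+ 2) :+ (b :+ w) :+ (y :+ (m :+ q))
              := y :+ (xo :+ con (+ 1)) :+ (b :+ q :+ m :+ (w :+ con (+ 1)))) refl
              (x r + o) (b r) (fromℕ w) (fromℕ m) (fromℕ q) (Y (k ℕ.+ m ℕ.* n))))
          close
          where m = w ℕ.+ (1 ℕ.∸ q)

      -- Passing from `t` to `t mod n` translates all gaps by the same number of turns, which goes
      -- into the common centre `β`. Two gaps within `D` of `β` differ by at most `D + D`.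
      spread-exists : ¬ (∀ (t : Fin n) → ¬ (∀ r r′ → gap x y r (toℕ t) - gap x y r′ (toℕ t) ≤ D + D))
      spread-exists none = shift-exists x-necklace y-necklace 0≤distance distance≤1
        (proj₁ o∈) (proj₁ (proj₂ o∈)) (toℕ s) (λ r → proj₁ (near r)) (λ r → proj₂ (near r)) λ t close → none (t mod n) (spread t close)
        where
        spread : ∀ t → (∀ i → Close D (X i + o + (1# + 1#)) (Y (i ℕ.+ t))) →
                 ∀ r r′ → gap x y r (toℕ (t mod n)) - gap x y r′ (toℕ (t mod n)) ≤ D + D
        spread t close r r′ = linear-≤ (upper r +≤ lower r′)
          (solve 4 (λ e e′ b D → e :- e′ :+ (b :+ D :+ (e′ :+ D)) := D :+ D :+ (e :+ b)) refl
            (gap x y r (toℕ (t mod n))) (gap x y r′ (toℕ (t mod n))) β D)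
          where
          β : ℝ
          β = fromℕ (t / n) - (o + (1# + 1#))
          wrap : ∀ r → Y (toℕ r ℕ.+ t) ≈ Y (toℕ r ℕ.+ toℕ (t mod n)) + fromℕ (t / n)
          wrap r = trans (reflexive (≡.cong Y (≡.trans (≡.cong (toℕ r ℕ.+_) (mod-decompose t))
            (≡.sym (ℕ.+-assoc (toℕ r) (toℕ (t mod n)) _))))) (unroll-+* y (toℕ r ℕ.+ toℕ (t mod n)) (t / n))
          close-gap : ∀ r → Close D (gap x y r (toℕ (t mod n))) β
          close-gap r = Close-shift (linear-≈ (+-cong (sym (unroll-toℕ x r)) (wrap r))
            (solve 6 (λ x y q o X Y → x :- y :+ Y :+ (X :+ (y :+ q))
              := q :- (o :+ con (+ 2)) :+ (X :+ o :+ con (+ 2)) :+ (x :+ Y)) refl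
              (x r) (Y (toℕ r ℕ.+ toℕ (t mod n))) (fromℕ (t / n)) o (X (toℕ r)) (Y (toℕ r ℕ.+ t)))) (close (toℕ r))
          upper : ∀ r → gap x y r (toℕ (t mod n)) ≤ β + D
          upper r = proj₁ (close-gap r)
          lower : ∀ r → β ≤ gap x y r (toℕ (t mod n)) + D
          lower r = proj₂ (close-gap r)

      -- Whole turns cost nothing, as `d°≤-shifted` accepts every integer translate: here the `q`
      -- turns of the index plus the `z` turns of the offset, less one if `_mod1` wrapped.
      distance-≤ : ∀ {V c} z → o ≈ c + fromℤ z → (∀ r → Close V (x r + c) (Y (toℕ r ℕ.+ toℕ s))) → D ≤ V
      distance-≤ {V} {c} z o≈ close = let r , eq = maximum-attained (λ r → d° (a r) (b r)) in
        ≤-respˡ-≈ (reflexive (≡.sym eq)) (d°≤ r)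
        where
        module _ (r : Fin n) where
          q : ℕ
          q = (toℕ r ℕ.+ toℕ s) / n
          x+o≈ : x r + o ≈ (x r + c) + fromℤ z
          x+o≈ = trans (+-congˡ o≈) (sym (+-assoc (x r) c (fromℤ z)))
          unwrapped : a r ≈ x r + o → d° (a r) (b r) ≤ V
          unwrapped a≈ = d°≤-shifted k (Close-shift
            (linear-≈ (+-cong (trans a≈ x+o≈) (sym (fromℤ-+ (+ q) z)))
              (solve 6 (λ a xc b q z k → a :+ (b :+ q) :+ (xc :+ z :+ k)
                := b :+ k :+ xc :+ (a :+ (q :+ z))) refl
                (a r) (x r + c) (b r) (fromℕ q) (fromℤ z) (fromℤ k))) (close r))
            where k = + q ℤ.+ z
          wrapped : a r + 1# ≈ x r + o → d° (a r) (b r) ≤ V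
          wrapped a≈ = d°≤-shifted k (Close-shift
            (linear-≈ (+-cong (trans a≈ x+o≈) (trans (+-congʳ (sym (fromℤ-+ (+ q) z)))
                (sym (fromℤ-+ (+ q ℤ.+ z) -[1+ 0 ]))))
              (solve 6 (λ a xc b q z k → a :+ (b :+ q) :+ (xc :+ z :+ k)
                := b :+ k :+ xc :+ (a :+ con (+ 1) :+ (q :+ z :+ con -[1+ 0 ]))) refl
                (a r) (x r + c) (b r) (fromℕ q) (fromℤ z) (fromℤ k))) (close r))
            where k = + q ℤ.+ z ℤ.+ -[1+ 0 ]

          d°≤ : d° (a r) (b r) ≤ V
          d°≤ = [ unwrapped , wrapped ]′ (proj₂ (moved o∈ r))

    gap≤1 : ∀ r t → gap x y r t ≤ 1#
    gap≤1 r t = linear-≤ (bead≤1 x-necklace r +≤ 0≤bead y-necklace (k mod n) +≤ 0≤fromℕ (k / n))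
      (solve 3 (λ x y q → x :- (y :+ q) :+ (con (+ 1) :+ (y :+ q)) := con (+ 1) :+ (x :+ (con (+ 0) :+ con (+ 0))))
        refl (x r) (y (k mod n)) (fromℕ (k / n)))
      where k = toℕ r ℕ.+ t

    -- The partner of bead `r` lies in the first two turns, strictly below two. The strictness
    -- excludes a centre of exactly two, which subtracting one turn would not bring below one.
    -2<gap : ∀ r {t} → t ℕ.< n → ¬ (gap x y r t + (1# + 1#) ≤ 0#)
    -2<gap r {t} t<n gap≤-2 = <⇒≱ (proj₂ (IsNecklace.inUnit y-necklace (k mod n)))
      (linear-≤ (gap≤-2 +≤ 0≤bead x-necklace r +≤ fromℕ-mono (/n≤1 r t<n))
        (solve 3 (λ x y q → con (+ 1) :+ (con (+ 0) :+ (x :+ con (+ 1)))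
            := y :+ (x :- (y :+ q) :+ con (+ 2) :+ (con (+ 0) :+ q)))
          refl (x r) (y (k mod n)) (fromℕ (k / n))))
      where k = toℕ r ℕ.+ t

    module _ {t : ℕ} (t<n : t ℕ.< n) {lo hi : ℝ} (extremes : Extremes x y t lo hi) where

      open Extremes extremes

      -1≤centre : 0# ≤ centre lo hi + 1#
      -1≤centre with lo-attained | hi-attained
      ... | r , ≡.refl | r′ , ≡.refl = double-cancel-≤ (linear-≤
          (≤-reflexive (sym (centre+centre lo hi)) +≤ gap≤1 r t +≤ gap≤1 r′ t)
          (solve 3 (λ m lo hi → con (+ 0) :+ con (+ 0) :+ (m :+ m :+ (con (+ 1) :+ con (+ 1)))
            := m :+ con (+ 1) :+ (m :+ con (+ 1)) :+ (con (+ 0) :- (hi :+ lo) :+ (lo :+ hi)))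
            refl (centre lo hi) lo hi))

      centre<2 : ¬ (1# + 1# ≤ centre lo hi)
      centre<2 2≤ with lo-attained
      ... | r , ≡.refl = -2<gap r t<n (double-cancel-≤ (linear-≤
          (2≤ +≤ 2≤ +≤ ≤-reflexive (centre+centre lo hi) +≤ ≤-hi r)
          (solve 3 (λ m lo hi → lo :+ con (+ 2) :+ (lo :+ con (+ 2)) :+ (m :+ (m :+ (con (+ 0) :- (hi :+ lo) :+ hi)))
            := con (+ 0) :+ con (+ 0) :+ (con (+ 2) :+ (con (+ 2) :+ (m :+ m :+ lo))))
            refl (centre lo hi) lo hi)))

      close-centre : ∀ r → Close (half (hi - lo)) (x r + centre lo hi) (Y (toℕ r ℕ.+ t))
      close-centre r =
        double-cancel-≤ (linear-≤ (≤-hi r +≤ ≤-hi r +≤ ≤-reflexive (centre+centre lo hi)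
            +≤ ≤-reflexive (sym (half+half (hi - lo))))
          (solve 6 (λ v m lo hi x y → x :+ m :+ (x :+ m) :+ (hi :+ (hi :+ (con (+ 0) :- (hi :+ lo) :+ (v :+ v))))
            := y :+ v :+ (y :+ v) :+ (x :- y :+ (x :- y :+ (m :+ m :+ (hi :- lo)))))
            refl (half (hi - lo)) (centre lo hi) lo hi (x r) (Y (toℕ r ℕ.+ t)))) ,
        double-cancel-≤ (linear-≤ (lo-≤ r +≤ lo-≤ r +≤ ≤-reflexive (sym (centre+centre lo hi))
            +≤ ≤-reflexive (sym (half+half (hi - lo))))
          (solve 6 (λ v m lo hi x y → y :+ y :+ (x :- y :+ (x :- y :+ (m :+ m :+ (v :+ v))))
            := x :+ m :+ v :+ (x :+ m :+ v) :+ (lo :+ (lo :+ (con (+ 0) :- (hi :+ lo) :+ (hi :- lo)))))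
            refl (half (hi - lo)) (centre lo hi) lo hi (x r) (Y (toℕ r ℕ.+ t))))

    -- `spread-exists` bounds every distance from below by half of some width, possibly for a shift
    -- `t` other than `s′`; this is why `best` compares all shifts. `distance-≤` shows that the
    -- centred offset attains the bound.
    optimal : ∀ {lo hi : Fin n → ℝ} → (∀ t → Extremes x y (toℕ t) (lo t) (hi t)) →
              ∀ s → (∀ t → hi s - lo s ≤ hi t - lo t) →
              ∀ {o} z → InUnit o → o ≈ centre (lo s) (hi s) + fromℤ z →
              IsOptimal x y (half (hi s - lo s)) o s
    optimal {lo} {hi} extremes s best {o} z o∈ o≈ = record
      { offset  = o∈
      ; value   = antisym (minimal o s o∈)
          (distance-≤ o∈ s z o≈ (close-centre (Fin.toℕ<n s) (extremes s)))
      ; minimal = minimal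
      }
      where
      minimal : ∀ o′ s′ → InUnit o′ → half (hi s - lo s) ≤ distance x y o′ s′
      -- Here the double negation of `spread-exists` is discharged.
      minimal o′ s′ o′∈ = decidable-stable (_ ≤? _) λ v≰D → spread-exists o′∈ s′ λ t spread →
        v≰D (double-cancel-≤ (≤-respˡ-≈ (sym (half+half (hi s - lo s))) (≤-trans (best t) (narrow t spread))))
        where
        narrow : ∀ t → (∀ r r′ → gap x y r (toℕ t) - gap x y r′ (toℕ t) ≤ distance x y o′ s′ + distance x y o′ s′) →
                 hi t - lo t ≤ distance x y o′ s′ + distance x y o′ s′
        narrow t spread = let r , hi≡ = Extremes.hi-attained (extremes t)
                              r′ , lo≡ = Extremes.lo-attained (extremes t)
          in ≤-respˡ-≈ (reflexive (≡.sym (≡.cong₂ _-_ hi≡ lo≡))) (spread r r′)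

-- Gaps as entries of the two convolutions.

module Convolutions {c ℓ₁ ℓ₂} (R : Reals c ℓ₁ ℓ₂) {n : ℕ} .{{n≢0 : NonZero n}} where

  open Reals R renaming (Carrier to ℝ)
  open OverReals R
  open Necklaces R {n}
  private
    module ⊓± = MinimumOf totalOrder±
    module ⊔± = MinimumOf (flip totalOrder±)

  [≤]-injective : ∀ {a b : ℝ} → [ a ] ≤± [ b ] → a ≤ b
  [≤]-injective [ a≤b ] = a≤b

  -- Total on the naturals, so that it can also be the target of `Filled`.
  padded : Vector ℝ n → ℝ ± → ℕ → ℝ ±
  padded x e j with j ℕ.<? n
  ... | yes j<n = [ x (opposite (fromℕ< j<n)) ]
  ... | no  _   = e

  padded-toℕ : ∀ x e r → padded x e (toℕ r) ≡ [ x (opposite r) ]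
  padded-toℕ x e r with toℕ r ℕ.<? n
  ... | yes r<n = ≡.cong (λ r → [ x (opposite r) ]) (Fin.fromℕ<-toℕ r r<n)
  ... | no  r≮n = contradiction (Fin.toℕ<n r) r≮n

  padded-≥ : ∀ x e {j} → n ℕ.≤ j → padded x e j ≡ e
  padded-≥ x e {j} n≤j with j ℕ.<? n
  ... | yes j<n = contradiction j<n (ℕ.≤⇒≯ n≤j)
  ... | no  _   = ≡.refl

  defined-finite : ∀ u b → Defined u [ b ]
  defined-finite ⊥±    b = tt
  defined-finite [ _ ] b = tt
  defined-finite ⊤±    b = tt

  minus-⊤ : ∀ {u b} d → u ≡ ⊤± → minus u [ b ] d ≡ ⊤±
  minus-⊤ d ≡.refl = ≡.refl

  minus-⊥ : ∀ {u b} d → u ≡ ⊥± → minus u [ b ] d ≡ ⊥±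
  minus-⊥ d ≡.refl = ≡.refl

  minus-finite : ∀ {u a b} d → u ≡ [ a ] → minus u [ b ] d ≡ [ a - b ]
  minus-finite d ≡.refl = ≡.refl

  module _ (x y : Vector ℝ n) where

    unrolled : Vector (ℝ ±) (2 ℕ.* n)
    unrolled i = [ unroll y (toℕ i) ]

    reversed : ℝ ± → Vector (ℝ ±) (2 ℕ.* n)
    reversed e i = padded x e (toℕ i)

    convolvable : ∀ e → Convolvable (reversed e) unrolled
    convolvable e position i = defined-finite (reversed e (left position i)) _

    last+ : ∀ s → n ℕ.∸ 1 ℕ.+ toℕ s ℕ.< 2 ℕ.* n
    last+ s = ℕ.+-mono-≤ {suc (n ℕ.∸ 1)} {n} (ℕ.≤-reflexive (ℕ.suc-pred n))
      (≡.subst (toℕ s ℕ.≤_) (≡.sym (ℕ.+-identityʳ n)) (ℕ.<⇒≤ (Fin.toℕ<n s)))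

    module _ (s : Fin n) where

      position : Fin (2 ℕ.* n)
      position = fromℕ< (last+ s)

      toℕ-position : toℕ position ≡ n ℕ.∸ 1 ℕ.+ toℕ s
      toℕ-position = Fin.toℕ-fromℕ< (last+ s)

      entries : ∀ e → Vector (ℝ ±) (suc (toℕ position))
      entries e = differences (reversed e) unrolled (convolvable e) position

      module _ (i : Fin (suc (toℕ position))) (r : Fin n) (i≡r : toℕ i ≡ toℕ r) where

        -- The two indices of a convolution entry have a fixed sum, those of a gap a fixed
        -- difference; reversing `x` converts one into the other. With sum `n - 1 + s`, index `r` of
        -- the reversed vector, which holds bead `opposite r`, meets exactly its partner.
        right≡ : toℕ (right position i) ≡ toℕ (opposite r) ℕ.+ toℕ s
        right≡ = begin
          toℕ (right position i)                      ≡⟨ Fin.toℕ-inject≤ (opposite i) _ ⟩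
          toℕ (opposite i)                            ≡⟨ Fin.opposite-prop i ⟩
          toℕ position ℕ.∸ toℕ i                      ≡⟨ ≡.cong₂ ℕ._∸_ toℕ-position i≡r ⟩
          (n ℕ.∸ 1 ℕ.+ toℕ s) ℕ.∸ toℕ r               ≡⟨ ℕ.+-∸-comm (toℕ s) (ℕ.pred-mono-≤ (Fin.toℕ<n r)) ⟩
          n ℕ.∸ 1 ℕ.∸ toℕ r ℕ.+ toℕ s                 ≡⟨ ≡.cong (ℕ._+ toℕ s) (ℕ.∸-+-assoc n 1 (toℕ r)) ⟩
          n ℕ.∸ suc (toℕ r) ℕ.+ toℕ s                 ≡⟨ ≡.cong (ℕ._+ toℕ s) (Fin.opposite-prop r) ⟨
          toℕ (opposite r) ℕ.+ toℕ s                  ∎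
          where open ≡-Reasoning

        entry-finite : ∀ e → entries e i ≡ [ gap x y (opposite r) (toℕ s) ]
        entry-finite e = ≡.trans
          (minus-finite _ (≡.trans (≡.cong (padded x e) (≡.trans (Fin.toℕ-inject≤ i _) i≡r)) (padded-toℕ x e r)))
          (≡.cong (λ j → [ x (opposite r) - unroll y j ]) right≡)

      index-of : Fin n → Fin (suc (toℕ position))
      index-of r = fromℕ< (ℕ.s≤s (ℕ.≤-trans (ℕ.pred-mono-≤ (Fin.toℕ<n (opposite r)))
        (≡.subst (n ℕ.∸ 1 ℕ.≤_) (≡.sym toℕ-position) (ℕ.m≤m+n (n ℕ.∸ 1) (toℕ s)))))

      entry-of : ∀ e r → entries e (index-of r) ≡ [ gap x y r (toℕ s) ]
      entry-of e r = ≡.trans (entry-finite (index-of r) (opposite r) (Fin.toℕ-fromℕ< _) e)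
        (≡.cong (λ r → [ gap x y r (toℕ s) ]) (Fin.opposite-involutive r))

      entry-cases : ∀ e i → reversed e (left position i) ≡ e ⊎
                    (∃[ r ] entries e i ≡ [ gap x y r (toℕ s) ])
      entry-cases e i with toℕ i ℕ.<? n
      ... | yes i<n = inj₂ (_ , entry-finite i (fromℕ< i<n) (≡.sym (Fin.toℕ-fromℕ< i<n)) e)
      ... | no  i≮n = inj₁ (padded-≥ x e (≡.subst (n ℕ.≤_) (≡.sym (Fin.toℕ-inject≤ i _)) (ℕ.≮⇒≥ i≮n)))

      -- The minimum is not attained on the padding: it would be infinite, yet it is at most the
      -- finite entry of any bead, for which `s` is taken.
      minimal-gap : ∃[ r ] (minConvolution (reversed ⊤±) unrolled (convolvable ⊤±) position ≡ [ gap x y r (toℕ s) ]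
                      × (∀ r′ → gap x y r (toℕ s) ≤ gap x y r′ (toℕ s)))
      minimal-gap = finite (entry-cases ⊤± i)
        where
        v : Vector (ℝ ±) (suc (toℕ position))
        v = entries ⊤±
        i : Fin (suc (toℕ position))
        i = proj₁ (⊓±.minimumOf-attained v)
        attained : ⊓±.minimumOf v ≡ v i
        attained = proj₂ (⊓±.minimumOf-attained v)
        minimal : ∀ {u} → v i ≡ u → ∀ r → u ≤± [ gap x y r (toℕ s) ]
        minimal eq r = ≡.subst₂ _≤±_ (≡.trans attained eq) (entry-of ⊤± r) (⊓±.minimumOf-≤ v (index-of r))
        finite : reversed ⊤± (left position i) ≡ ⊤± ⊎ (∃[ r ] v i ≡ [ gap x y r (toℕ s) ]) → _
        finite (inj₁ eq)       = contradiction (minimal (minus-⊤ _ eq) s) λ ()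
        finite (inj₂ (r , eq)) = r , ≡.trans attained eq , λ r′ → [≤]-injective (minimal eq r′)

      maximal-gap : ∃[ r ] (maxConvolution (reversed ⊥±) unrolled (convolvable ⊥±) position ≡ [ gap x y r (toℕ s) ]
                      × (∀ r′ → gap x y r′ (toℕ s) ≤ gap x y r (toℕ s)))
      maximal-gap = finite (entry-cases ⊥± i)
        where
        v : Vector (ℝ ±) (suc (toℕ position))
        v = entries ⊥±
        i : Fin (suc (toℕ position))
        i = proj₁ (⊔±.minimumOf-attained v)
        attained : ⊔±.minimumOf v ≡ v i
        attained = proj₂ (⊔±.minimumOf-attained v)
        maximal : ∀ {u} → v i ≡ u → ∀ r → [ gap x y r (toℕ s) ] ≤± u
        maximal eq r = ≡.subst₂ _≤±_ (entry-of ⊥± r) (≡.trans attained eq) (⊔±.minimumOf-≤ v (index-of r))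
        finite : reversed ⊥± (left position i) ≡ ⊥± ⊎ (∃[ r ] v i ≡ [ gap x y r (toℕ s) ]) → _
        finite (inj₁ eq)       = contradiction (maximal (minus-⊥ _ eq) s) λ { Order⁺.[ () ] }
        finite (inj₂ (r , eq)) = r , ≡.trans attained eq , λ r′ → [≤]-injective (maximal eq r′)

    lo hi : Fin n → ℝ
    lo s = gap x y (proj₁ (minimal-gap s)) (toℕ s)
    hi s = gap x y (proj₁ (maximal-gap s)) (toℕ s)

    minConvolution-lo : ∀ s → minConvolution (reversed ⊤±) unrolled (convolvable ⊤±) (position s) ≡ [ lo s ]
    minConvolution-lo s = proj₁ (proj₂ (minimal-gap s))

    maxConvolution-hi : ∀ s → maxConvolution (reversed ⊥±) unrolled (convolvable ⊥±) (position s) ≡ [ hi s ]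
    maxConvolution-hi s = proj₁ (proj₂ (maximal-gap s))

    extremes : ∀ s → Extremes x y (toℕ s) (lo s) (hi s)
    extremes s = record
      { lo-≤        = proj₂ (proj₂ (minimal-gap s))
      ; ≤-hi        = proj₂ (proj₂ (maximal-gap s))
      ; lo-attained = proj₁ (minimal-gap s) , ≡.refl
      ; hi-attained = proj₁ (maximal-gap s) , ≡.refl
      }

-- The two programs.

size : IExp
size = load (lit 0)

construct-cell : IExp
construct-cell = load (lit 1)

construct-step : Program
construct-step =
  (2 at construct-cell ≔ᴿ fetch 0 (size ⊖ (lit 1 ⊕ construct-cell))) ⨾
  (2 at size ⊕ construct-cell ≔ᴿ +∞) ⨾
  (3 at construct-cell ≔ᴿ fetch 0 (size ⊖ (lit 1 ⊕ construct-cell))) ⨾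
  (3 at size ⊕ construct-cell ≔ᴿ -∞) ⨾
  -- Adding zero makes the content `y r + fromℕ 0`, the value of `unroll` up to `_≡_`; `y r` itself
  -- agrees with it only up to `_≈_`.
  (4 at construct-cell ≔ᴿ fetch 1 construct-cell ⊞ zeroᴿ) ⨾
  (4 at size ⊕ construct-cell ≔ᴿ fetch 1 construct-cell ⊞ oneᴿ) ⨾
  (lit 1 ≔ᴵ lit 1 ⊕ construct-cell)

construct : Program
construct = (lit 1 ≔ᴵ lit 0) ⨾ (while lit 1 ⊕ construct-cell ≤ᴵ size loop construct-step)

-- As x is reversed, the differences for the shift s meet at position n - 1 + s.
entry : ℕ → IExp → RExp
entry b s = fetch b (size ⊖ lit 1 ⊕ s)

best current : IExp
best    = load (lit 1)
current = load (lit 2)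

width : RExp
width = entry 6 current ⊟ entry 5 current

-- Cell 0 of bank 7 holds the least width so far, cell 1 of the index memory the
-- shift attaining it.  The midpoint lies in [-1, 2), so that recover-wrap need
-- add or subtract at most one turn.
recover-start recover-step recover-result recover-wrap recover : Program
recover-start =
  (lit 1 ≔ᴵ lit 0) ⨾
  (lit 2 ≔ᴵ lit 0) ⨾
  -- Shift 0 seeds the search; the loop then examines it again.
  (7 at lit 0 ≔ᴿ width)
recover-step =
  (if width ≤ᴿ fetch 7 (lit 0)
     then ((7 at lit 0 ≔ᴿ width) ⨾ (lit 1 ≔ᴵ current))
     else′ skip) ⨾
  (lit 2 ≔ᴵ lit 1 ⊕ current)
recover-result =
  (7 at lit 1 ≔ᴿ (zeroᴿ ⊟ (entry 6 best ⊞ entry 5 best)) ⊘ (oneᴿ ⊞ oneᴿ)) ⨾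
  (7 at lit 0 ≔ᴿ fetch 7 (lit 0) ⊘ (oneᴿ ⊞ oneᴿ))
recover-wrap =
  if oneᴿ ≤ᴿ fetch 7 (lit 1)
    then (7 at lit 1 ≔ᴿ fetch 7 (lit 1) ⊟ oneᴿ)
    else′ (if zeroᴿ ≤ᴿ fetch 7 (lit 1)
      then skip
      else′ (7 at lit 1 ≔ᴿ fetch 7 (lit 1) ⊞ oneᴿ))
recover =
  recover-start ⨾
  (while lit 1 ⊕ current ≤ᴵ size loop recover-step) ⨾
  recover-result ⨾
  recover-wrap

-- Memory updates.

≡ᵇ-refl : ∀ p → (p ℕ.≡ᵇ p) ≡ true
≡ᵇ-refl zero    = ≡.refl
≡ᵇ-refl (suc p) = ≡ᵇ-refl p

≢⇒≡ᵇ-false : ∀ {p q} → ¬ (p ≡ q) → (p ℕ.≡ᵇ q) ≡ false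
≢⇒≡ᵇ-false {zero}  {zero}  p≢q = contradiction ≡.refl p≢q
≢⇒≡ᵇ-false {zero}  {suc q} p≢q = ≡.refl
≢⇒≡ᵇ-false {suc p} {zero}  p≢q = ≡.refl
≢⇒≡ᵇ-false {suc p} {suc q} p≢q = ≢⇒≡ᵇ-false λ p≡q → p≢q (≡.cong suc p≡q)

module _ {a} {A : Set a} where

  update : (ℕ → A) → ℕ → A → ℕ → A
  update f p u q = if p ℕ.≡ᵇ q then u else f q

  update-hit : ∀ f p u → update f p u p ≡ u
  update-hit f p u rewrite ≡ᵇ-refl p = ≡.refl

  update-miss : ∀ f {p} u {q} → ¬ (p ≡ q) → update f p u q ≡ f q
  update-miss f u p≢q rewrite ≢⇒≡ᵇ-false p≢q = ≡.refl

  -- The two halves of an array of length 2n are filled in parallel.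
  Filled : ℕ → (F f : ℕ → A) → ℕ → Set a
  Filled n F f k = ∀ j → j ℕ.< k → f j ≡ F j × f (n ℕ.+ j) ≡ F (n ℕ.+ j)

  filled-zero : ∀ {n F f} → Filled n F f 0
  filled-zero j ()

  -- Addresses and contents enter through equations, so that the expressions evaluated by the
  -- machine fit as they are. By `k < n` the two writes hit different halves, and neither disturbs
  -- an earlier cell.
  filled-suc : ∀ {n F f k p p′ u v} → k ℕ.< n → p ≡ k → p′ ≡ n ℕ.+ k → u ≡ F k → v ≡ F (n ℕ.+ k) →
               Filled n F f k → Filled n F (update (update f p u) p′ v) (suc k)
  filled-suc {n} {F} {f} {k} k<n ≡.refl ≡.refl ≡.refl ≡.refl filled j j<1+k
    with ℕ.m≤n⇒m<n∨m≡n (ℕ.≤-pred j<1+k)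
  ... | inj₁ j<k =
    ≡.trans (update-miss (update f k (F k)) (F (n ℕ.+ k))
        (λ eq → ℕ.<⇒≢ (ℕ.<-≤-trans (ℕ.<-trans j<k k<n) (ℕ.m≤m+n n k)) (≡.sym eq)))
      (≡.trans (update-miss f (F k) (λ eq → ℕ.<⇒≢ j<k (≡.sym eq))) (proj₁ (filled j j<k))) ,
    ≡.trans (update-miss (update f k (F k)) (F (n ℕ.+ k)) (λ eq → ℕ.<⇒≢ j<k (≡.sym (ℕ.+-cancelˡ-≡ n k j eq))))
      (≡.trans (update-miss f (F k) (ℕ.<⇒≢ (ℕ.<-≤-trans k<n (ℕ.m≤m+n n j)))) (proj₂ (filled j j<k)))
  ... | inj₂ ≡.refl =
    ≡.trans (update-miss (update f k (F k)) (F (n ℕ.+ k))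
        (λ eq → ℕ.<⇒≢ (ℕ.<-≤-trans k<n (ℕ.m≤m+n n k)) (≡.sym eq)))
      (update-hit f k (F k)) ,
    update-hit (update f k (F k)) (n ℕ.+ k) (F (n ℕ.+ k))

  filled-all : ∀ {n F f} → Filled n F f n → (i : Fin (2 ℕ.* n)) → f (toℕ i) ≡ F (toℕ i)
  filled-all {n} {F} {f} filled i with toℕ i ℕ.<? n
  ... | yes i<n = proj₁ (filled (toℕ i) i<n)
  ... | no  i≮n = ≡.subst (λ j → f j ≡ F j) (ℕ.m+[n∸m]≡n (ℕ.≮⇒≥ i≮n)) (proj₂ (filled (toℕ i ℕ.∸ n)
    (≡.subst (toℕ i ℕ.∸ n ℕ.<_) (≡.trans (ℕ.m+n∸m≡n n (n ℕ.+ 0)) (ℕ.+-identityʳ n))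
      (ℕ.∸-monoˡ-< (Fin.toℕ<n i) (ℕ.≮⇒≥ i≮n)))))

-- Absorbs the constant cost outside a loop into the linear bound.
affine≤linear : ∀ a b n .{{_ : NonZero n}} → a ℕ.* n ℕ.+ b ℕ.≤ (a ℕ.+ b) ℕ.* n
affine≤linear a b n =
  ℕ.≤-trans (ℕ.+-monoʳ-≤ (a ℕ.* n) (ℕ.m≤m*n b n)) (ℕ.≤-reflexive (≡.sym (ℕ.*-distribʳ-+ n a b)))

-- Composing executions and bounding loops.

module Executions {c ℓ₁ ℓ₂} (R : Reals c ℓ₁ ℓ₂) where

  open OverReals R

  fetch-≡ : ∀ {σ b e u} → bank σ b (⟦ e ⟧ σ) ≡ u → σ ⊢ fetch b e ↦ u
  fetch-≡ {σ} {b} {e} eq = ≡.subst (σ ⊢ fetch b e ↦_) eq (fetch b e)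

  module _ {ℓ ℓ′} {P : State → Set ℓ} {Q : State → Set ℓ′} where

    halts-⨾ : ∀ {p q σ S T} → HaltsWithin p σ S P → (∀ τ → P τ → HaltsWithin q τ T Q) →
              HaltsWithin (p ⨾ q) σ (S ℕ.+ T) Q
    halts-⨾ (s , τ , p⇓ , s≤S , Pτ) next = let t , υ , q⇓ , t≤T , Qυ = next τ Pτ in
      s ℕ.+ t , υ , (p⇓ ⨾ q⇓) , ℕ.+-mono-≤ s≤S t≤T , Qυ

    halts-weaken : ∀ {p σ S T} → S ℕ.≤ T → (∀ τ → P τ → Q τ) → HaltsWithin p σ S P → HaltsWithin p σ T Q
    halts-weaken S≤T P⇒Q (s , τ , p⇓ , s≤S , Pτ) = s , τ , p⇓ , ℕ.≤-trans s≤S S≤T , P⇒Q τ Pτ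

  module _ {ℓ} (I : ℕ → State → Set ℓ) {g : Test} {p : Program} {n T : ℕ}
           (step : ∀ k σ → k ℕ.< n → I k σ → (σ ⊢ g ↝ true) × HaltsWithin p σ T (I (suc k)))
           (exit : ∀ σ → I n σ → σ ⊢ g ↝ false) where

    -- Induction on the number `m` of rounds left, the invariant being indexed by the rounds done.
    -- The final `1` pays for the failing guard.
    loop-from : ∀ m k → k ℕ.+ m ≡ n → ∀ σ → I k σ →
                HaltsWithin (while g loop p) σ (m ℕ.* suc T ℕ.+ 1) (I n)
    loop-from zero k eq σ Iσ = 1 , σ , while-false (exit σ Iₙσ) , ℕ.≤-refl , Iₙσ
      where Iₙσ = ≡.subst (λ k → I k σ) (≡.trans (≡.sym (ℕ.+-identityʳ k)) eq) Iσ
    loop-from (suc m) k eq σ Iσ =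
      let 1+k+m≡n = ≡.trans (≡.sym (ℕ.+-suc k m)) eq
          g↝true , s , τ , p⇓ , s≤T , Iτ = step k σ (≡.subst (suc k ℕ.≤_) 1+k+m≡n (ℕ.m≤m+n (suc k) m)) Iσ
          t , υ , w⇓ , t≤ , Iυ = loop-from m (suc k) 1+k+m≡n τ Iτ
      in suc (s ℕ.+ t) , υ , while-true g↝true p⇓ w⇓ ,
         ℕ.s≤s (ℕ.≤-trans (ℕ.+-mono-≤ s≤T t≤) (ℕ.≤-reflexive (≡.sym (ℕ.+-assoc T (m ℕ.* suc T) 1)))) , Iυ

    loop-halts : ∀ σ → I 0 σ → HaltsWithin (while g loop p) σ (suc T ℕ.* n ℕ.+ 1) (I n)
    loop-halts σ I₀ = ≡.subst (λ t → HaltsWithin (while g loop p) σ (t ℕ.+ 1) (I n)) (ℕ.*-comm n (suc T))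
      (loop-from n 0 ≡.refl σ I₀)

  counter-< : ∀ {σ a b k n} → ⟦ a ⟧ σ ≡ k → ⟦ b ⟧ σ ≡ n → k ℕ.< n → σ ⊢ lit 1 ⊕ a ≤ᴵ b ↝ true
  counter-< ≡.refl ≡.refl k<n = yesᴵ k<n

  counter-≥ : ∀ {σ a b n} → ⟦ a ⟧ σ ≡ n → ⟦ b ⟧ σ ≡ n → σ ⊢ lit 1 ⊕ a ≤ᴵ b ↝ false
  counter-≥ ≡.refl eq = noᴵ λ n<n → ℕ.<-irrefl (≡.sym eq) n<n

-- Correctness and cost of `construct`.

module Construct {c ℓ₁ ℓ₂} (R : Reals c ℓ₁ ℓ₂) {n : ℕ} .{{n≢0 : NonZero n}}
                 (x y : Vector (Reals.Carrier R) n) where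

  open OverReals R
  open Executions R
  open Residues {n}
  open Necklaces R {n}
  open Convolutions R {n}

  record Constructed (k : ℕ) (σ : State) : Set c where
    field
      size-≡     : index σ 0 ≡ n
      counter-≡  : index σ 1 ≡ k
      holds-x    : Holds σ 0 (λ i → [ x i ])
      holds-y    : Holds σ 1 (λ i → [ y i ])
      filled-x′  : Filled n (padded x ⊤±) (bank σ 2) k
      filled-x″  : Filled n (padded x ⊥±) (bank σ 3) k
      filled-y′  : Filled n (λ j → [ unroll y j ]) (bank σ 4) k

  construct-step-halts : ∀ k σ → k ℕ.< n → Constructed k σ → HaltsWithin construct-step σ 7 (Constructed (suc k))
  construct-step-halts k σ k<n I = 7 , _ ,
      (assignᴿ (fetch _ _) ⨾ assignᴿ +∞ ⨾ assignᴿ (fetch _ _) ⨾ assignᴿ -∞ ⨾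
       assignᴿ (fetch-≡ y≡ ⊞ zeroᴿ) ⨾ assignᴿ (fetch-≡ y≡ ⊞ oneᴿ) ⨾ assignᴵ) ,
      ℕ.≤-refl , record
      { size-≡    = size-≡
      ; counter-≡ = ≡.cong suc counter-≡
      ; holds-x   = holds-x
      ; holds-y   = holds-y
      ; filled-x′ = filled-suc k<n counter-≡ high (x≡ ⊤±) (≡.sym (padded-≥ x ⊤± n≤n+k)) filled-x′
      ; filled-x″ = filled-suc k<n counter-≡ high (x≡ ⊥±) (≡.sym (padded-≥ x ⊥± n≤n+k)) filled-x″
      ; filled-y′ = filled-suc k<n counter-≡ high (≡.cong [_] (≡.sym (unroll-≡ y k-mod (m<n⇒m/n≡0 k<n))))
                      (≡.cong [_] (≡.sym (unroll-≡ y n+k-mod n+k-div))) filled-y′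
      }
    where
    open Constructed I
    r : Fin n
    r = fromℕ< k<n
    toℕ-r : toℕ r ≡ k
    toℕ-r = Fin.toℕ-fromℕ< k<n
    n≤n+k : n ℕ.≤ n ℕ.+ k
    n≤n+k = ℕ.m≤m+n n k
    high : index σ 0 ℕ.+ index σ 1 ≡ n ℕ.+ k
    high = ≡.cong₂ ℕ._+_ size-≡ counter-≡
    x≡ : ∀ e → bank σ 0 (index σ 0 ℕ.∸ suc (index σ 1)) ≡ padded x e k
    x≡ e = ≡.trans (≡.cong (bank σ 0) (≡.trans (≡.cong₂ (λ m j → m ℕ.∸ suc j) size-≡ (≡.trans counter-≡ (≡.sym toℕ-r)))
        (≡.sym (Fin.opposite-prop r))))
      (≡.trans (holds-x (opposite r)) (≡.trans (≡.sym (padded-toℕ x e r)) (≡.cong (padded x e) toℕ-r)))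
    y≡ : bank σ 1 (index σ 1) ≡ [ y r ]
    y≡ = ≡.trans (≡.cong (bank σ 1) (≡.trans counter-≡ (≡.sym toℕ-r))) (holds-y r)
    k-mod : k mod n ≡ r
    k-mod = ≡.trans (≡.cong (_mod n) (≡.sym toℕ-r)) (mod-toℕ r)
    n+k≡ : n ℕ.+ k ≡ k ℕ.+ 1 ℕ.* n
    n+k≡ = ≡.trans (ℕ.+-comm n k) (≡.cong (k ℕ.+_) (≡.sym (ℕ.*-identityˡ n)))
    n+k-mod : (n ℕ.+ k) mod n ≡ r
    n+k-mod = ≡.trans (≡.cong (_mod n) n+k≡) (≡.trans (mod-+* k 1) k-mod)
    n+k-div : (n ℕ.+ k) / n ≡ 1
    n+k-div = ≡.trans (≡.cong (_/ n) n+k≡) (≡.trans (/-+* k 1) (≡.cong (ℕ._+ 1) (m<n⇒m/n≡0 k<n)))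

  construct-halts : ∀ σ → HoldsInput x y σ →
    HaltsWithin construct σ (10 ℕ.* n) (HoldsVectors (reversed x y ⊤±) (reversed x y ⊥±) (unrolled x y))
  construct-halts σ (n≡ , hx , hy) = halts-weaken (bound n)
    (λ τ I → filled-all (filled-x′ I) , filled-all (filled-x″ I) , filled-all (filled-y′ I))
    (halts-⨾ {P = Constructed 0} (1 , _ , assignᴵ , ℕ.≤-refl , record
        { size-≡    = n≡
        ; counter-≡ = ≡.refl
        ; holds-x   = hx
        ; holds-y   = hy
        ; filled-x′ = filled-zero
        ; filled-x″ = filled-zero
        ; filled-y′ = filled-zero
        })
      (loop-halts Constructed
        (λ k τ k<n I → counter-< (counter-≡ I) (size-≡ I) k<n , construct-step-halts k τ k<n I)
        (λ τ I → counter-≥ (counter-≡ I) (size-≡ I))))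
    where
    open Constructed
    -- One initial assignment, a guard and seven assignments per round, and the failing guard.
    bound : ∀ n .{{_ : NonZero n}} → 1 ℕ.+ (8 ℕ.* n ℕ.+ 1) ℕ.≤ 10 ℕ.* n
    bound n = ℕ.≤-trans (ℕ.≤-reflexive (≡.sym (ℕ.+-suc (8 ℕ.* n) 1))) (affine≤linear 8 2 n)

-- Correctness and cost of `recover`.

module Recover {c ℓ₁ ℓ₂} (R : Reals c ℓ₁ ℓ₂) {n : ℕ} .{{n≢0 : NonZero n}}
               (lo hi : Fin n → Reals.Carrier R) where

  open Reals R renaming (Carrier to ℝ)
  open OverReals R
  open OrderedField R
  open Executions R
  open Necklaces R {n}

  gap-width : Fin n → ℝ
  gap-width s = hi s - lo s

  record Available (σ : State) : Set c where
    field
      size-≡ : index σ 0 ≡ n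
      lo-≡   : ∀ s → bank σ 5 (n ℕ.∸ 1 ℕ.+ toℕ s) ≡ [ lo s ]
      hi-≡   : ∀ s → bank σ 6 (n ℕ.∸ 1 ℕ.+ toℕ s) ≡ [ hi s ]

    address : ∀ {j} s → j ≡ toℕ s → index σ 0 ℕ.∸ 1 ℕ.+ j ≡ n ℕ.∸ 1 ℕ.+ toℕ s
    address s j≡ = ≡.cong₂ (λ m j → m ℕ.∸ 1 ℕ.+ j) size-≡ j≡

    lo↦ : ∀ {e} s → ⟦ e ⟧ σ ≡ toℕ s → σ ⊢ entry 5 e ↦ [ lo s ]
    lo↦ s e≡ = fetch-≡ (≡.trans (≡.cong (bank σ 5) (address s e≡)) (lo-≡ s))

    hi↦ : ∀ {e} s → ⟦ e ⟧ σ ≡ toℕ s → σ ⊢ entry 6 e ↦ [ hi s ]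
    hi↦ s e≡ = fetch-≡ (≡.trans (≡.cong (bank σ 6) (address s e≡)) (hi-≡ s))

    width↦ : ∀ s → index σ 2 ≡ toℕ s → σ ⊢ width ↦ [ gap-width s ]
    width↦ s current≡ = hi↦ s current≡ ⊟ lo↦ s current≡

  record Searched (k : ℕ) (σ : State) : Set (c Level.⊔ ℓ₁ Level.⊔ ℓ₂) where
    field
      available : Available σ
      current-≡ : index σ 2 ≡ k
      s         : Fin n
      best-≡    : index σ 1 ≡ toℕ s
      width-≡   : bank σ 7 0 ≡ [ gap-width s ]
      narrowest : ∀ t → toℕ t ℕ.< k → gap-width s ≤ gap-width t

  below-suc : ∀ {ℓ} {P : Fin n → Set ℓ} (r : Fin n) → P r → (∀ t → toℕ t ℕ.< toℕ r → P t) →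
              ∀ t → toℕ t ℕ.< suc (toℕ r) → P t
  below-suc {P = P} r Pr P< t t<1+r = [ P< t , (λ t≡r → ≡.subst P (≡.sym (Fin.toℕ-injective t≡r)) Pr) ]′
    (ℕ.m≤n⇒m<n∨m≡n (ℕ.≤-pred t<1+r))

  recover-step-halts : ∀ r σ → Searched (toℕ r) σ → HaltsWithin recover-step σ 4 (Searched (suc (toℕ r)))
  recover-step-halts r σ I with gap-width r ≤? gap-width (Searched.s I)
  ... | yes w≤ = _ , _ ,
      (if-true (yesᴿ (width↦ r current-≡) (fetch-≡ width-≡) [ w≤ ]) (assignᴿ (width↦ r current-≡) ⨾ assignᴵ) ⨾
       assignᴵ) ,
      ℕ.≤-refl , record
      -- The step writes only to bank 7 and to index cells 1 and 2, so these facts carry over by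
      -- computation.
      { available = record { size-≡ = size-≡ ; lo-≡ = lo-≡ ; hi-≡ = hi-≡ }
      ; current-≡ = ≡.cong suc current-≡
      ; s         = r
      ; best-≡    = current-≡
      ; width-≡   = ≡.refl
      ; narrowest = below-suc r ≤-refl λ t t<r → ≤-trans w≤ (narrowest t t<r)
      }
    where
    open Searched I
    open Available available
  ... | no w≰ = _ , _ ,
      (if-false (noᴿ (width↦ r current-≡) (fetch-≡ width-≡) λ { [ w≤ ] → w≰ w≤ }) skip ⨾ assignᴵ) ,
      ℕ.s≤s (ℕ.s≤s ℕ.z≤n) , record
      { available = record { size-≡ = size-≡ ; lo-≡ = lo-≡ ; hi-≡ = hi-≡ }
      ; current-≡ = ≡.cong suc current-≡
      ; s         = s
      ; best-≡    = best-≡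
      ; width-≡   = width-≡
      ; narrowest = below-suc r (≰⇒≥ w≰) narrowest
      }
    where
    open Searched I
    open Available available

  record Centred (σ : State) : Set (c Level.⊔ ℓ₁ Level.⊔ ℓ₂) where
    field
      s         : Fin n
      best-≡    : index σ 1 ≡ toℕ s
      value-≡   : bank σ 7 0 ≡ [ half (gap-width s) ]
      centre-≡  : bank σ 7 1 ≡ [ centre (lo s) (hi s) ]
      narrowest : ∀ t → gap-width s ≤ gap-width t

  record Recovered (σ : State) : Set (c Level.⊔ ℓ₁ Level.⊔ ℓ₂) where
    field
      s         : Fin n
      o         : ℝ
      turns     : ℤ
      best-≡    : index σ 1 ≡ toℕ s
      value-≡   : bank σ 7 0 ≡ [ half (gap-width s) ]
      offset-≡  : bank σ 7 1 ≡ [ o ]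
      o-inUnit  : InUnit o
      o-centred : o ≈ centre (lo s) (hi s) + fromℤ turns
      narrowest : ∀ t → gap-width s ≤ gap-width t

  recover-start-halts : ∀ σ → Available σ → HaltsWithin recover-start σ 3 (Searched 0)
  recover-start-halts σ I = _ , _ ,
      -- `width` is evaluated after both index cells have been reset, hence in the state of
      -- `initialised`.
      (assignᴵ ⨾ assignᴵ ⨾ assignᴿ (Available.width↦ initialised first (≡.sym zero-≡))) ,
      ℕ.≤-refl , record
      { available = record { size-≡ = size-≡ ; lo-≡ = lo-≡ ; hi-≡ = hi-≡ }
      ; current-≡ = ≡.refl
      ; s         = first
      ; best-≡    = ≡.sym zero-≡
      ; width-≡   = ≡.refl
      ; narrowest = λ t ()
      }
    where
    open Available I
    first : Fin n
    first = fromℕ< (ℕ.>-nonZero⁻¹ n)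
    zero-≡ : toℕ first ≡ 0
    zero-≡ = Fin.toℕ-fromℕ< (ℕ.>-nonZero⁻¹ n)
    initialised : Available (setIndex (setIndex σ 1 0) 2 0)
    initialised = record { size-≡ = size-≡ ; lo-≡ = lo-≡ ; hi-≡ = hi-≡ }

  recover-result-halts : ∀ σ → Searched n σ → HaltsWithin recover-result σ 2 Centred
  recover-result-halts σ I = _ , _ ,
      (assignᴿ (quot (zeroᴿ ⊟ (hi↦ s best-≡ ⊞ lo↦ s best-≡)) (oneᴿ ⊞ oneᴿ) 2≉0) ⨾
      assignᴿ (quot (fetch-≡ width-≡) (oneᴿ ⊞ oneᴿ) 2≉0)) ,
      ℕ.≤-refl , record
      { s         = s
      ; best-≡    = best-≡
      ; value-≡   = ≡.refl
      ; centre-≡  = ≡.refl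
      ; narrowest = λ t → narrowest t (Fin.toℕ<n t)
      }
    where
    open Searched I
    open Available available

  module _ (-1≤ : ∀ s → 0# ≤ centre (lo s) (hi s) + 1#)
           (<2  : ∀ s → ¬ (1# + 1# ≤ centre (lo s) (hi s))) where

    recover-wrap-halts : ∀ σ → Centred σ → HaltsWithin recover-wrap σ 3 Recovered
    recover-wrap-halts σ I = wrap (1# ≤? m) (0# ≤? m)
      where
      open Centred I
      m : ℝ
      m = centre (lo s) (hi s)
      m↦ : σ ⊢ fetch 7 (lit 1) ↦ [ m ]
      m↦ = fetch-≡ centre-≡
      recovered : ∀ {τ} o z → index τ 1 ≡ index σ 1 → bank τ 7 0 ≡ bank σ 7 0 → bank τ 7 1 ≡ [ o ] →
                  InUnit o → o ≈ m + fromℤ z → Recovered τ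
      recovered o z 1≡ 0≡ o≡ o∈ o≈ = record
        { s = s ; o = o ; turns = z ; best-≡ = ≡.trans 1≡ best-≡ ; value-≡ = ≡.trans 0≡ value-≡ ; offset-≡ = o≡
        ; o-inUnit = o∈ ; o-centred = o≈ ; narrowest = narrowest }
      wrap : Dec (1# ≤ m) → Dec (0# ≤ m) → HaltsWithin recover-wrap σ 3 Recovered
      -- The outer branches get one end of the unit interval from a test and the other from `<2` or
      -- `-1≤`; the middle branch gets both from the tests.
      wrap (yes 1≤m) _ = _ , _ , if-true (yesᴿ oneᴿ m↦ [ 1≤m ]) (assignᴿ (m↦ ⊟ oneᴿ)) , ℕ.n≤1+n 2 ,
        recovered (m - 1#) -[1+ 0 ] ≡.refl ≡.refl ≡.refl
          ( linear-≤ 1≤m (solve 1 (λ m → con (+ 0) :+ m := m :- con (+ 1) :+ con (+ 1)) refl m)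
          , ≰⇒> λ 1≤ → <2 s (linear-≤ 1≤
              (solve 1 (λ m → con (+ 2) :+ (m :- con (+ 1)) := m :+ con (+ 1)) refl m)))
          refl
      wrap (no 1≰m) (yes 0≤m) = _ , _ ,
        if-false (noᴿ oneᴿ m↦ λ { [ 1≤m ] → 1≰m 1≤m }) (if-true (yesᴿ zeroᴿ m↦ [ 0≤m ]) skip) , ℕ.n≤1+n 2 ,
        recovered m (+ 0) ≡.refl ≡.refl centre-≡ (0≤m , ≰⇒> 1≰m) (sym (+-identityʳ m))
      wrap (no 1≰m) (no 0≰m) = _ , _ ,
        if-false (noᴿ oneᴿ m↦ λ { [ 1≤m ] → 1≰m 1≤m })
          (if-false (noᴿ zeroᴿ m↦ λ { [ 0≤m ] → 0≰m 0≤m }) (assignᴿ (m↦ ⊞ oneᴿ))) , ℕ.≤-refl ,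
        recovered (m + 1#) (+ 1) ≡.refl ≡.refl ≡.refl
          ( -1≤ s
          , ≰⇒> λ 1≤m+1 → 0≰m (linear-≤ 1≤m+1
              (solve 1 (λ m → con (+ 0) :+ (m :+ con (+ 1)) := m :+ con (+ 1)) refl m)))
          refl

    recover-halts : ∀ σ → Available σ → HaltsWithin recover σ (14 ℕ.* n) Recovered
    recover-halts σ I = halts-weaken (bound n) (λ τ Rτ → Rτ)
      (halts-⨾ (recover-start-halts σ I) λ τ₁ I₁ →
       halts-⨾ (loop-halts Searched
           step (λ τ I → counter-≥ (current-≡ I) (size-≡ (available I)))
           τ₁ I₁) λ τ₂ I₂ →
       halts-⨾ (recover-result-halts τ₂ I₂) recover-wrap-halts)
      where
      open Searched
      open Available using (size-≡)
      step : ∀ k τ → k ℕ.< n → Searched k τ →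
             (τ ⊢ lit 1 ⊕ current ≤ᴵ size ↝ true) × HaltsWithin recover-step τ 4 (Searched (suc k))
      step k τ k<n I = counter-< (current-≡ I) (size-≡ (available I)) k<n ,
        ≡.subst (λ k → HaltsWithin recover-step τ 4 (Searched (suc k))) (Fin.toℕ-fromℕ< k<n)
          (recover-step-halts (fromℕ< k<n) τ (≡.subst (λ k → Searched k τ) (≡.sym (Fin.toℕ-fromℕ< k<n)) I))
      -- Three steps to start, a guard and at most four steps per round, the failing guard, two
      -- steps for the result and at most three to wrap the offset.
      bound : ∀ n .{{_ : NonZero n}} → 3 ℕ.+ (5 ℕ.* n ℕ.+ 1 ℕ.+ (2 ℕ.+ 3)) ℕ.≤ 14 ℕ.* n
      bound n = ℕ.≤-trans (ℕ.≤-reflexive (≡.trans (ℕ.+-comm 3 _) (≡.trans (ℕ.+-assoc (5 ℕ.* n ℕ.+ 1) 5 3)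
        (ℕ.+-assoc (5 ℕ.* n) 1 8)))) (affine≤linear 5 9 n)

-- The reduction assembled.

open import Data.Nat.Base using (_*_)

theorem3 : ∀ {c ℓ₁ ℓ₂} (R : Reals c ℓ₁ ℓ₂) →
    let open Reals R using () renaming (Carrier to ℝ)
        open OverReals R
    in
    Σ[ construct ∈ Program ] Σ[ recover ∈ Program ] Σ[ C ∈ ℕ ]
    (∀ (n : ℕ) .{{_ : NonZero n}} (x y : Vector ℝ n) → IsNecklace x → IsNecklace y →
      Σ[ x′ ∈ Vector (ℝ ±) (2 * n) ] Σ[ x″ ∈ Vector (ℝ ±) (2 * n) ] Σ[ y′ ∈ Vector (ℝ ±) (2 * n) ]
      Σ[ d′ ∈ Convolvable x′ y′ ] Σ[ d″ ∈ Convolvable x″ y′ ]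
        ( (∀ σ → HoldsInput x y σ →
             HaltsWithin construct σ (C * n) (HoldsVectors x′ x″ y′))
        × (∀ σ → HoldsInput x y σ →
             HoldsConvolutions (minConvolution x′ y′ d′) (maxConvolution x″ y′ d″) σ →
             HaltsWithin recover σ (C * n) (HoldsSolution x y))))
-- The larger of the two constants: `14` for `recover`, against `10` for `construct`.
theorem3 R = construct , recover , 14 , reduction
  where
  open OverReals R
  open Executions R

  reduction : ∀ n .{{_ : NonZero n}} (x y : Vector (Reals.Carrier R) n) → IsNecklace x → IsNecklace y → _
  reduction n x y x-necklace y-necklace =
    reversed x y ⊤± , reversed x y ⊥± , unrolled x y , convolvable x y ⊤± , convolvable x y ⊥± ,
    (λ σ input → halts-weaken (ℕ.*-monoˡ-≤ n (ℕ.m≤m+n 10 4)) (λ τ Hτ → Hτ) (construct-halts σ input)) ,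
    λ σ (size-≡ , _) (holds-z , holds-w) → halts-weaken ℕ.≤-refl solved
      (recover-halts (λ s → -1≤centre x-necklace y-necklace (Fin.toℕ<n s) (extremes x y s))
                     (λ s → centre<2 x-necklace y-necklace (Fin.toℕ<n s) (extremes x y s)) σ record
        { size-≡ = size-≡
        ; lo-≡   = λ s → ≡.trans (≡.cong (bank σ 5) (≡.sym (toℕ-position x y s)))
                         (≡.trans (holds-z (position x y s)) (minConvolution-lo x y s))
        ; hi-≡   = λ s → ≡.trans (≡.cong (bank σ 6) (≡.sym (toℕ-position x y s)))
                         (≡.trans (holds-w (position x y s)) (maxConvolution-hi x y s))
        })
    where
    open Convolutions R {n}
    open Construct R {n} x y
    open Necklaces R {n}
    open Recover R {n} (lo x y) (hi x y)
    solved : ∀ τ → Recovered τ → HoldsSolution x y τ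
    solved τ I = _ , o , s , value-≡ , offset-≡ , best-≡ ,
      optimal x-necklace y-necklace (extremes x y) s narrowest turns o-inUnit o-centred
      where open Recovered I
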